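{- Let $G$ be a connected threshold graph of order $n\ge 4$ and size $m$ with $n-1<m<\binom{n}{2}$, let $c$ be its number of type 1 vertices, $(b_1,\ldots,b_z)$ its backwards zero position sequence, $F_1=\sum_{i=1}^z b_i^2$, and $\rho$ the spectral radius of its adjacency matrix. Then \[\rho\ge\frac{c-2+\sqrt{c^2+\frac{4}{c-1}F_1}}{2}.\]
   Context: A threshold graph is a simple graph whose vertices can be ordered $v_1,\ldots,v_n$ so that for each $2\le i\le n$, $v_i$ is either adjacent to all of $v_1,\ldots,v_{i-1}$ (then $a_i=1$) or to none of them (then $a_i=0$); by convention $a_1=1$. Vertex $v_i$ is of type 1 if $a_i=1$ and of type 0 if $a_i=0$; $c$ and $z$ are the numbers of type 1 and type 0 vertices. The backwards zero position sequence $(b_1,\ldots,b_z)$ is defined by letting $b_i$ be the number of type 1 vertices appearing after the $i$-th type 0 vertex in the order $v_1,\ldots,v_n$. -}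

module Defs where

open import Level using (Level; _⊔_; suc; Lift; lift; lower)
open import Algebra.Bundles using (CommutativeRing)
open import Algebra.Structures using (IsCommutativeRing)
open import Algebra.Core using (Op₁; Op₂)
open import Data.Bool using (Bool; true; false; if_then_else_; not; _∧_)
open import Data.Fin using (Fin; toℕ) renaming (_<_ to _<ᶠ_)
open import Data.Fin.Permutation using (Permutation′; _⟨$⟩ʳ_)
open import Data.List using (List; length; map; allFin; filterᵇ; cartesianProduct)
open import Data.Nat using (ℕ; _^_; _<ᵇ_)
open import Data.Nat.ListAction using (sum)
open import Data.Product using (∃; ∃₂; _×_; _,_; proj₁; proj₂)
open import Data.Sum using (inj₁; inj₂)
open import Data.Vec.Functional using (Vector)
open import Relation.Binary.Core using (Rel)
open import Relation.Binary.Bundles using (Poset)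
open import Relation.Binary.Structures using (IsDecTotalOrder)
open import Relation.Binary.Construct.Closure.ReflexiveTransitive using (Star)
open import Relation.Binary.PropositionalEquality using (_≡_)
open import Relation.Nullary using (¬_; yes; no; contradiction)
import Algebra.Properties.Semiring.Mult as SemiringMult
import Algebra.Properties.Semiring.Sum as SemiringSum
import Algebra.Solver.Ring.NaturalCoefficients.Default as NatSolver
import Relation.Binary.Reasoning.PartialOrder as PosetReasoning

------------------------------------------------------------------------
-- Real numbers

-- The library has no real numbers.  They are described here by the usual
-- categorical axioms: a totally ordered field in which every inhabited
-- subset that is bounded above has a least upper bound.  As in classical
-- mathematics, the order is decidable.

record CompleteOrderedField (a ℓ₁ ℓ₂ : Level) : Set (suc (a ⊔ ℓ₁ ⊔ ℓ₂)) where
  infix  8 -_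
  infix  9 _⁻¹
  infixl 7 _*_
  infixl 6 _+_
  infix  4 _≈_ _≤_
  field
    Carrier           : Set a
    _≈_               : Rel Carrier ℓ₁
    _≤_               : Rel Carrier ℓ₂
    _+_ _*_           : Op₂ Carrier
    -_                : Op₁ Carrier
    0# 1#             : Carrier
    isCommutativeRing : IsCommutativeRing _≈_ _+_ _*_ -_ 0# 1#
    isDecTotalOrder   : IsDecTotalOrder _≈_ _≤_

    -- The value of 0# ⁻¹ is unspecified.
    _⁻¹               : Op₁ Carrier
    ⁻¹-inverseʳ       : ∀ x → ¬ x ≈ 0# → x * x ⁻¹ ≈ 1#
    1≉0               : ¬ 1# ≈ 0#

    +-monoʳ-≤         : ∀ x {y z} → y ≤ z → x + y ≤ x + z
    *-nonNeg          : ∀ {x y} → 0# ≤ x → 0# ≤ y → 0# ≤ x * y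

    supremum          : (P : Carrier → Set (a ⊔ ℓ₁ ⊔ ℓ₂)) →
                        ∃ P →
                        (∃ λ b → ∀ x → P x → x ≤ b) →
                        ∃ λ s → (∀ x → P x → x ≤ s) ×
                                (∀ b → (∀ x → P x → x ≤ b) → s ≤ b)

  commutativeRing : CommutativeRing a ℓ₁
  commutativeRing = record { isCommutativeRing = isCommutativeRing }

  open CommutativeRing commutativeRing public
    hiding (Carrier; _≈_; _+_; _*_; -_; 0#; 1#; isCommutativeRing)

  module Order = IsDecTotalOrder isDecTotalOrder

  poset : Poset a ℓ₁ ℓ₂
  poset = record { isPartialOrder = Order.isPartialOrder }

  infixl 7 _/_
  _/_ : Op₂ Carrier
  x / y = x * y ⁻¹

  open SemiringMult semiring public using () renaming (_×_ to _×ₙ_)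

  fromℕ : ℕ → Carrier
  fromℕ k = k ×ₙ 1#

------------------------------------------------------------------------
-- Square roots, derived from completeness

module SquareRoot {a ℓ₁ ℓ₂ : Level} (ℝ : CompleteOrderedField a ℓ₁ ℓ₂) where
  open CompleteOrderedField ℝ
  open Order using (antisym; total; _≤?_)
    renaming (trans to ≤-trans; reflexive to ≤-reflexive; refl to ≤-refl; _≟_ to _≈?_)
  open PosetReasoning poset
  open NatSolver commutativeSemiring

  x≤x+y : ∀ x {y} → 0# ≤ y → x ≤ x + y
  x≤x+y x {y} 0≤y = begin
    x       ≈⟨ sym (+-identityʳ x) ⟩
    x + 0#  ≤⟨ +-monoʳ-≤ x 0≤y ⟩
    x + y   ∎

  +-nonNeg : ∀ {x y} → 0# ≤ x → 0# ≤ y → 0# ≤ x + y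
  +-nonNeg {x} 0≤x 0≤y = ≤-trans 0≤x (x≤x+y x 0≤y)

  ≤⇒∃+ : ∀ {x y} → x ≤ y → ∃ λ d → 0# ≤ d × y ≈ x + d
  ≤⇒∃+ {x} {y} x≤y = - x + y , 0≤d , eq
    where
    0≤d : 0# ≤ - x + y
    0≤d = begin
      0#       ≈⟨ sym (-‿inverseˡ x) ⟩
      - x + x  ≤⟨ +-monoʳ-≤ (- x) x≤y ⟩
      - x + y  ∎
    eq : y ≈ x + (- x + y)
    eq = begin-equality
      y              ≈⟨ sym (+-identityˡ y) ⟩
      0# + y         ≈⟨ +-congʳ (sym (-‿inverseʳ x)) ⟩
      x + - x + y    ≈⟨ +-assoc x (- x) y ⟩
      x + (- x + y)  ∎

  +-cancelˡ-≤ : ∀ x {y z} → x + y ≤ x + z → y ≤ z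
  +-cancelˡ-≤ x {y} {z} p = begin
    y              ≈⟨ lem y ⟩
    - x + (x + y)  ≤⟨ +-monoʳ-≤ (- x) p ⟩
    - x + (x + z)  ≈⟨ sym (lem z) ⟩
    z              ∎
    where
    lem : ∀ w → w ≈ - x + (x + w)
    lem w = begin-equality
      w              ≈⟨ sym (+-identityˡ w) ⟩
      0# + w         ≈⟨ +-congʳ (sym (-‿inverseˡ x)) ⟩
      - x + x + w    ≈⟨ +-assoc (- x) x w ⟩
      - x + (x + w)  ∎

  *-monoˡ-≤-nonNeg : ∀ {z x y} → 0# ≤ z → x ≤ y → z * x ≤ z * y
  *-monoˡ-≤-nonNeg {z} {x} {y} 0≤z x≤y with ≤⇒∃+ x≤y
  ... | d , 0≤d , y≈ = begin
    z * x          ≤⟨ x≤x+y (z * x) (*-nonNeg 0≤z 0≤d) ⟩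
    z * x + z * d  ≈⟨ sym (distribˡ z x d) ⟩
    z * (x + d)    ≈⟨ *-congˡ (sym y≈) ⟩
    z * y          ∎

  0≤x² : ∀ x → 0# ≤ x * x
  0≤x² x with total 0# x
  ... | inj₁ 0≤x = *-nonNeg 0≤x 0≤x
  ... | inj₂ x≤0 with ≤⇒∃+ x≤0
  ... | e , 0≤e , 0≈x+e = begin
    0#                   ≤⟨ *-nonNeg 0≤e 0≤e ⟩
    e * e                ≈⟨ sym (+-identityˡ (e * e)) ⟩
    0# + e * e           ≈⟨ +-congʳ (sym (zeroʳ x)) ⟩
    x * 0# + e * e       ≈⟨ +-congʳ (*-congˡ 0≈x+e) ⟩
    x * (x + e) + e * e  ≈⟨ solve 2 (λ x e → x :* (x :+ e) :+ e :* e := x :* x :+ (x :+ e) :* e) refl x e ⟩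
    x * x + (x + e) * e  ≈⟨ +-congˡ (*-congʳ (sym 0≈x+e)) ⟩
    x * x + 0# * e       ≈⟨ +-congˡ (zeroˡ e) ⟩
    x * x + 0#           ≈⟨ +-identityʳ (x * x) ⟩
    x * x                ∎

  0≤1 : 0# ≤ 1#
  0≤1 = ≤-trans (0≤x² 1#) (≤-reflexive (*-identityˡ 1#))

  1≰0 : ¬ 1# ≤ 0#
  1≰0 1≤0 = 1≉0 (antisym 1≤0 0≤1)

  ⁻¹-nonNeg : ∀ {x} → 0# ≤ x → ¬ x ≈ 0# → 0# ≤ x ⁻¹
  ⁻¹-nonNeg {x} 0≤x x≉0 with total 0# (x ⁻¹)
  ... | inj₁ 0≤x⁻¹ = 0≤x⁻¹
  ... | inj₂ x⁻¹≤0 = contradiction lem 1≰0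
    where
    lem : 1# ≤ 0#
    lem = begin
      1#        ≈⟨ sym (⁻¹-inverseʳ x x≉0) ⟩
      x * x ⁻¹  ≤⟨ *-monoˡ-≤-nonNeg 0≤x x⁻¹≤0 ⟩
      x * 0#    ≈⟨ zeroʳ x ⟩
      0#        ∎

  x²≈0⇒x≈0 : ∀ {x} → x * x ≈ 0# → x ≈ 0#
  x²≈0⇒x≈0 {x} x²≈0 with x ≈? 0#
  ... | yes x≈0 = x≈0
  ... | no  x≉0 = begin-equality
    x               ≈⟨ sym (*-identityʳ x) ⟩
    x * 1#          ≈⟨ *-congˡ (sym (⁻¹-inverseʳ x x≉0)) ⟩
    x * (x * x ⁻¹)  ≈⟨ sym (*-assoc x x (x ⁻¹)) ⟩
    x * x * x ⁻¹    ≈⟨ *-congʳ x²≈0 ⟩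
    0# * x ⁻¹       ≈⟨ zeroˡ (x ⁻¹) ⟩
    0#              ∎

  x²≤y²⇒x≤y : ∀ {x y} → 0# ≤ y → x * x ≤ y * y → x ≤ y
  x²≤y²⇒x≤y {x} {y} 0≤y x²≤y² with total x y
  ... | inj₁ x≤y = x≤y
  ... | inj₂ y≤x with ≤⇒∃+ y≤x
  ... | e , 0≤e , x≈y+e = begin
    x       ≈⟨ x≈y+e ⟩
    y + e   ≈⟨ +-congˡ (x²≈0⇒x≈0 (antisym e²≤0 (0≤x² e))) ⟩
    y + 0#  ≈⟨ +-identityʳ y ⟩
    y       ∎
    where
    e²≤0 : e * e ≤ 0#
    e²≤0 = +-cancelˡ-≤ (y * y) (begin
      y * y + e * e                    ≤⟨ x≤x+y _ (+-nonNeg (*-nonNeg 0≤y 0≤e) (*-nonNeg 0≤y 0≤e)) ⟩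
      y * y + e * e + (y * e + y * e)  ≈⟨ solve 2 (λ y e → y :* y :+ e :* e :+ (y :* e :+ y :* e)
                                                     := (y :+ e) :* (y :+ e)) refl y e ⟩
      (y + e) * (y + e)                ≈⟨ *-cong (sym x≈y+e) (sym x≈y+e) ⟩
      x * x                            ≤⟨ x²≤y² ⟩
      y * y                            ≈⟨ sym (+-identityʳ (y * y)) ⟩
      y * y + 0#                       ∎)

  private
    square-of-sum : ∀ s e → (s + e) * (s + e) ≈ s * s + e * (s + s) + e * e
    square-of-sum = solve 2 (λ s e → (s :+ e) :* (s :+ e) := s :* s :+ e :* (s :+ s) :+ e :* e) refl

    collect-ε : ∀ s e o d → s * s + e * (s + s) + e * (o + d) ≈ s * s + e * (o + (s + s + d))
    collect-ε = solve 4 (λ s e o d → s :* s :+ e :* (s :+ s) :+ e :* (o :+ d)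
                           := s :* s :+ e :* (o :+ (s :+ s :+ d))) refl

    swap : ∀ d k i → d * i * k ≈ d * (k * i)
    swap = solve 3 (λ d k i → d :* i :* k := d :* (k :* i)) refl

    swap′ : ∀ d p h → d * (p * h) ≈ p * (d * h)
    swap′ = solve 3 (λ d p h → d :* (p :* h) := p :* (d :* h)) refl

    newton₁ : ∀ s h x d →
      (s + s) * h * ((s + s) * h) * x + d * h * (d * h) ≈
      h * h * (s * s * x + s * s * x + s * s * x + s * s * x + d * d)
    newton₁ = solve 4 (λ s h x d →
      (s :+ s) :* h :* ((s :+ s) :* h) :* x :+ d :* h :* (d :* h) :=
      h :* h :* (s :* s :* x :+ s :* s :* x :+ s :* s :* x :+ s :* s :* x :+ d :* d)) refl

    newton₂ : ∀ h x d →
      h * h * ((x + d) * x + (x + d) * x + (x + d) * x + (x + d) * x + d * d) ≈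
      (x + d + x) * h * ((x + d + x) * h)
    newton₂ = solve 3 (λ h x d →
      h :* h :* ((x :+ d) :* x :+ (x :+ d) :* x :+ (x :+ d) :* x :+ (x :+ d) :* x :+ d :* d) :=
      (x :+ d :+ x) :* h :* ((x :+ d :+ x) :* h)) refl

  module _ {x s : Carrier} (0≤x : 0# ≤ x) (0≤s : 0# ≤ s)
           (upper : ∀ y → y * y ≤ x → y ≤ s)
           (least : ∀ b → (∀ y → y * y ≤ x → y ≤ b) → s ≤ b) where

    x≤s² : x ≤ s * s
    x≤s² with total x (s * s)
    ... | inj₁ x≤s² = x≤s²
    ... | inj₂ s²≤x with ≤⇒∃+ s²≤x
    ... | d , 0≤d , x≈s²+d = ≤-reflexive (begin-equality
        x           ≈⟨ x≈s²+d ⟩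
        s * s + d   ≈⟨ +-congˡ (sym εK≈d) ⟩
        s * s + ε * K   ≈⟨ +-congˡ (*-congʳ (antisym ε≤0 0≤ε)) ⟩
        s * s + 0# * K  ≈⟨ +-congˡ (zeroˡ K) ⟩
        s * s + 0#  ≈⟨ +-identityʳ (s * s) ⟩
        s * s       ∎)
      where
      r = s + s + d
      K = 1# + r
      0≤r : 0# ≤ r
      0≤r = +-nonNeg (+-nonNeg 0≤s 0≤s) 0≤d
      K≉0 : ¬ K ≈ 0#
      K≉0 K≈0 = 1≰0 (≤-trans (x≤x+y 1# 0≤r) (≤-reflexive K≈0))
      ε = d * K ⁻¹
      0≤ε : 0# ≤ ε
      0≤ε = *-nonNeg 0≤d (⁻¹-nonNeg (+-nonNeg 0≤1 0≤r) K≉0)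
      εK≈d : ε * K ≈ d
      εK≈d = begin-equality
        d * K ⁻¹ * K    ≈⟨ swap d K (K ⁻¹) ⟩
        d * (K * K ⁻¹)  ≈⟨ *-congˡ (⁻¹-inverseʳ K K≉0) ⟩
        d * 1#          ≈⟨ *-identityʳ d ⟩
        d               ∎
      ε≤1+d : ε ≤ 1# + d
      ε≤1+d = begin
        ε             ≤⟨ x≤x+y ε (*-nonNeg 0≤ε 0≤r) ⟩
        ε + ε * r     ≈⟨ +-congʳ (sym (*-identityʳ ε)) ⟩
        ε * 1# + ε * r  ≈⟨ sym (distribˡ ε 1# r) ⟩
        ε * K         ≈⟨ εK≈d ⟩
        d             ≤⟨ x≤x+y d 0≤1 ⟩
        d + 1#        ≈⟨ +-comm d 1# ⟩
        1# + d        ∎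
      ε≤0 : ε ≤ 0#
      ε≤0 = +-cancelˡ-≤ s (begin
        s + ε   ≤⟨ upper (s + ε) (begin
          (s + ε) * (s + ε)              ≈⟨ square-of-sum s ε ⟩
          s * s + ε * (s + s) + ε * ε    ≤⟨ +-monoʳ-≤ _ (*-monoˡ-≤-nonNeg 0≤ε ε≤1+d) ⟩
          s * s + ε * (s + s) + ε * (1# + d)  ≈⟨ collect-ε s ε 1# d ⟩
          s * s + ε * K                  ≈⟨ +-congˡ εK≈d ⟩
          s * s + d                      ≈⟨ sym x≈s²+d ⟩
          x                              ∎) ⟩
        s       ≈⟨ sym (+-identityʳ s) ⟩
        s + 0#  ∎)

    s²≤x : s * s ≤ x
    s²≤x with s ≈? 0# | total (s * s) x
    ... | _       | inj₁ s²≤x = s²≤x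
    ... | yes s≈0 | inj₂ _    = ≤-trans (≤-reflexive (trans (*-congʳ s≈0) (zeroˡ s))) 0≤x
    ... | no s≉0  | inj₂ _ with ≤⇒∃+ x≤s²
    ... | d , 0≤d , s²≈x+d = +-cancelˡ-≤ (s * s) (begin
        s * s + s * s  ≈⟨ sym (distribʳ s s s) ⟩
        D * s          ≤⟨ *-monoˡ-≤-nonNeg 0≤D (least t (λ y y²≤x → x²≤y²⇒x≤y 0≤t (≤-trans y²≤x x≤t²))) ⟩
        D * t          ≈⟨ swap′ D (s * s + x) h ⟩
        (s * s + x) * (D * h)  ≈⟨ *-congˡ Dh≈1 ⟩
        (s * s + x) * 1#  ≈⟨ *-identityʳ _ ⟩
        s * s + x      ∎)
      where
      D = s + s
      0≤D : 0# ≤ D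
      0≤D = +-nonNeg 0≤s 0≤s
      D≉0 : ¬ D ≈ 0#
      D≉0 D≈0 = s≉0 (antisym (≤-trans (x≤x+y s 0≤s) (≤-reflexive D≈0)) 0≤s)
      h = D ⁻¹
      Dh≈1 : D * h ≈ 1#
      Dh≈1 = ⁻¹-inverseʳ D D≉0
      t = (s * s + x) * h
      0≤t : 0# ≤ t
      0≤t = *-nonNeg (+-nonNeg (0≤x² s) 0≤x) (⁻¹-nonNeg 0≤D D≉0)
      x≤t² : x ≤ t * t
      x≤t² = begin
        x                            ≈⟨ sym (*-identityˡ x) ⟩
        1# * x                       ≈⟨ *-congʳ (sym (trans (*-cong Dh≈1 Dh≈1) (*-identityˡ 1#))) ⟩
        D * h * (D * h) * x          ≤⟨ x≤x+y _ (0≤x² (d * h)) ⟩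
        D * h * (D * h) * x + d * h * (d * h)
          ≈⟨ newton₁ s h x d ⟩
        h * h * (s * s * x + s * s * x + s * s * x + s * s * x + d * d)
          ≈⟨ *-congˡ (+-congʳ (+-cong (+-cong (+-cong e e) e) e)) ⟩
        h * h * ((x + d) * x + (x + d) * x + (x + d) * x + (x + d) * x + d * d)
          ≈⟨ newton₂ h x d ⟩
        (x + d + x) * h * ((x + d + x) * h)  ≈⟨ *-cong f f ⟩
        t * t                        ∎
        where
        e : s * s * x ≈ (x + d) * x
        e = *-congʳ s²≈x+d
        f : (x + d + x) * h ≈ t
        f = *-congʳ (+-congʳ (sym s²≈x+d))

    lub²≈x : s * s ≈ x
    lub²≈x = antisym s²≤x x≤s²

  √-exists : ∀ x → 0# ≤ x → ∃ λ s → 0# ≤ s × s * s ≈ x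
  √-exists x 0≤x = s , 0≤s , lub²≈x 0≤x 0≤s upper least
    where
    Below : Carrier → Set (a ⊔ ℓ₁ ⊔ ℓ₂)
    Below y = Lift (a ⊔ ℓ₁ ⊔ ℓ₂) (y * y ≤ x)

    0∈Below : Below 0#
    0∈Below = lift (≤-trans (≤-reflexive (zeroˡ 0#)) 0≤x)

    bounded : ∀ y → Below y → y ≤ 1# + x
    bounded y y∈ = x²≤y²⇒x≤y (+-nonNeg 0≤1 0≤x) (begin
      y * y                    ≤⟨ lower y∈ ⟩
      x                        ≤⟨ x≤x+y x (+-nonNeg (+-nonNeg 0≤1 0≤x) (0≤x² x)) ⟩
      x + (1# + x + x * x)     ≈⟨ solve 1 (λ x → x :+ (con 1 :+ x :+ x :* x)
                                      := (con 1 :+ x) :* (con 1 :+ x)) refl x ⟩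
      (1# + x) * (1# + x)      ∎)

    sup = supremum Below (0# , 0∈Below) (1# + x , bounded)
    s = proj₁ sup

    upper : ∀ y → y * y ≤ x → y ≤ s
    upper y y²≤x = proj₁ (proj₂ sup) y (lift y²≤x)

    least : ∀ b → (∀ y → y * y ≤ x → y ≤ b) → s ≤ b
    least b h = proj₂ (proj₂ sup) b (λ y y∈ → h y (lower y∈))

    0≤s : 0# ≤ s
    0≤s = upper 0# (lower 0∈Below)

  -- Extended by zero to the negative numbers.
  √ : Carrier → Carrier
  √ x with 0# ≤? x
  ... | yes 0≤x = proj₁ (√-exists x 0≤x)
  ... | no  _   = 0#

------------------------------------------------------------------------
-- Spectral radius of a real square matrix

module Spectrum {a ℓ₁ ℓ₂ : Level} (ℝ : CompleteOrderedField a ℓ₁ ℓ₂) where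
  open CompleteOrderedField ℝ
  open SquareRoot ℝ public using (√)
  open SemiringSum semiring renaming (sum to ∑ᵛ)

  Matrix : ℕ → Set a
  Matrix n = Fin n → Fin n → Carrier

  infixr 7 _*ᵛ_
  _*ᵛ_ : ∀ {n} → Matrix n → Vector Carrier n → Vector Carrier n
  (A *ᵛ u) i = ∑ᵛ (λ j → A i j * u j)

  -- x + iy is a complex eigenvalue: A(u + iw) = (x + iy)(u + iw) for some
  -- non-zero complex vector u + iw, written out in real and imaginary parts.
  IsEigenvalue : ∀ {n} → Matrix n → Carrier → Carrier → Set (a ⊔ ℓ₁)
  IsEigenvalue {n} A x y =
    ∃₂ λ (u w : Vector Carrier n) →
      ¬ (∀ i → u i ≈ 0# × w i ≈ 0#) ×
      (∀ i → (A *ᵛ u) i ≈ x * u i - y * w i) ×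
      (∀ i → (A *ᵛ w) i ≈ x * w i + y * u i)

  modulus : Carrier → Carrier → Carrier
  modulus x y = √ (x * x + y * y)

  IsSpectralRadius : ∀ {n} → Matrix n → Carrier → Set (a ⊔ ℓ₁ ⊔ ℓ₂)
  IsSpectralRadius A ρ =
    (∃₂ λ x y → IsEigenvalue A x y × modulus x y ≈ ρ) ×
    (∀ x y → IsEigenvalue A x y → modulus x y ≤ ρ)

------------------------------------------------------------------------
-- Graphs

record SimpleGraph (n : ℕ) : Set where
  field
    adj        : Fin n → Fin n → Bool
    adj-sym    : ∀ u v → adj u v ≡ adj v u
    adj-irrefl : ∀ v → adj v v ≡ false

  Connected : Set
  Connected = ∀ u v → Star (λ x y → adj x y ≡ true) u v

  size : ℕ
  size = length (filterᵇ (λ (u , v) → (toℕ u <ᵇ toℕ v) ∧ adj u v)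
                         (cartesianProduct (allFin n) (allFin n)))

  adjacencyMatrix : ∀ {a ℓ₁ ℓ₂} (ℝ : CompleteOrderedField a ℓ₁ ℓ₂) → Spectrum.Matrix ℝ n
  adjacencyMatrix ℝ u v = if adj u v then 1# else 0#
    where open CompleteOrderedField ℝ

-- Positions are 0-based, so vertexAt ⟨$⟩ʳ i is v_{i+1} and type i is a_{i+1}
-- (true for type 1, false for type 0).
record ThresholdOrder {n : ℕ} (G : SimpleGraph n) : Set where
  open SimpleGraph G
  field
    vertexAt   : Permutation′ n
    type       : Fin n → Bool
    type-first : ∀ i → toℕ i ≡ 0 → type i ≡ true
    adj-type   : ∀ i j → j <ᶠ i → adj (vertexAt ⟨$⟩ʳ i) (vertexAt ⟨$⟩ʳ j) ≡ type i

  numType1 : ℕ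
  numType1 = length (filterᵇ type (allFin n))

  type0Positions : List (Fin n)
  type0Positions = filterᵇ (λ i → not (type i)) (allFin n)

  backwardsZeroPositions : List ℕ
  backwardsZeroPositions =
    map (λ i → length (filterᵇ (λ j → (toℕ i <ᵇ toℕ j) ∧ type j) (allFin n)))
        type0Positions

  F₁ : ℕ
  F₁ = sum (map (_^ 2) backwardsZeroPositions)

{-# OPTIONS --safe #-}
module Submission where

-- For a real symmetric matrix the supremum of the Rayleigh quotients is an
-- eigenvalue, so the spectral radius dominates every Rayleigh quotient.  Let
-- k = c − 1.  The first vertex has no type 0 neighbour, so it can be moved to the
-- independent side: the other k type 1 vertices form a clique, and the remaining
-- vertices are independent and have k, b₁, …, b_z neighbours in the clique.  The
-- vector equal to θ on the clique and to these degrees on the independent set has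
-- Rayleigh quotient θ when k θ (θ − (k − 1)) = k² + F₁, and the larger root of
-- this equation is the asserted bound.

-- That the supremum is an eigenvalue is usually proved by compactness of the unit sphere.
-- Completeness enters here only as least upper bounds, so attainment is replaced by algebra:
-- symmetric elimination shows that every symmetric matrix is positive definite with an explicit
-- constant, or has a kernel vector, or takes a negative value. For `s` times the identity minus the
-- matrix, with `s` the supremum, only a kernel vector is possible, and that is an eigenvector for
-- `s`.
--
-- The test vector solves the eigenvalue equation halfway. If it is constantly θ on the clique, the
-- equation at an independent vertex forces the value there to be the degree, and then holds
-- exactly. On the clique the equation is imposed only on average: summed over the k clique vertices
-- it reads k (k - 1) θ + k² + F₁ = k θ², which is the equation for θ.

open import Defs
open import Level using (Level; _⊔_)
open import Algebra.Bundles using (CommutativeRing; RawRing)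
open import Algebra.Solver.Ring.AlmostCommutativeRing
  using (fromCommutativeRing; _-Raw-AlmostCommutative⟶_)
open import Data.Bool using (Bool; true; false; if_then_else_; not; _∧_)
open import Data.Fin using (Fin; zero; suc; toℕ)
open import Data.Fin.Permutation using (_⟨$⟩ʳ_; _⟨$⟩ˡ_; inverseˡ; inverseʳ)
open import Data.List using (length; tabulate; filterᵇ; allFin)
open import Data.Maybe using (Maybe; map)
open import Data.Nat using (ℕ; zero; suc; s≤s; _∸_; _<_; _≥_)
open import Data.Nat.Combinatorics using (_C_)
open import Data.Product using (∃; ∃₂; _×_; _,_; proj₁; proj₂)
open import Data.Sum using (inj₁; inj₂)
open import Data.Vec.Functional using (Vector; _∷_; replicate)
open import Function using (_∘_)
open import Relation.Binary.Construct.Closure.ReflexiveTransitive using (_◅_)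
open import Relation.Binary.Definitions using (tri<; tri≈; tri>)
open import Relation.Binary.PropositionalEquality as ≡ using (_≡_)
open import Relation.Nullary using (¬_; yes; no; contradiction)
open import Relation.Nullary.Decidable using (dec-true; dec-false)
open import Relation.Nullary.Decidable.Core using (dec⇒maybe)
import Algebra.Properties.Ring as RingProperties
import Algebra.Properties.Semiring.Mult as SemiringMult
import Algebra.Properties.Semiring.Mult.TCOptimised as OptimisedMult
import Algebra.Properties.Semiring.Sum as SemiringSum
import Algebra.Solver.Ring as RingSolver
import Algebra.Solver.Ring.NaturalCoefficients.Default as NatSolver
import Data.Fin.Properties as Finₚ
import Data.List as List
import Data.Nat as ℕ
import Data.Nat.ListAction as ListAction
import Data.Nat.Properties as ℕₚ
import Relation.Binary.Reasoning.PartialOrder as PosetReasoning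
import Relation.Binary.Reasoning.Setoid as SetoidReasoning

-- Ring solver with integer coefficients.

-- The pair (m , n) stands for the integer m − n.
module IntegerCoefficients {a ℓ} (R : CommutativeRing a ℓ) where
  open CommutativeRing R
  open RingProperties ring
  open SetoidReasoning setoid
  open OptimisedMult semiring using (×-homo-+; ×1-homo-*) renaming (_×_ to _·_)

  private
    open NatSolver commutativeSemiring

    coefficients : RawRing _ _
    coefficients = record
      { Carrier = ℕ × ℕ
      ; _≈_     = _≡_
      ; _+_     = λ (m , n) (p , q) → m ℕ.+ p , n ℕ.+ q
      ; _*_     = λ (m , n) (p , q) → m ℕ.* p ℕ.+ n ℕ.* q , m ℕ.* q ℕ.+ n ℕ.* p
      ; -_      = λ (m , n) → n , m
      ; 0#      = 0 , 0
      ; 1#      = 1 , 0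
      }

    -- Cancelling here makes the values of equal coefficients definitionally equal.
    eval : ℕ × ℕ → Carrier
    eval (m     , zero ) = m · 1#
    eval (zero  , suc n) = - (suc n · 1#)
    eval (suc m , suc n) = eval (m , n)

    interchange : ∀ x y z w → x + y + (z + w) ≈ x + z + (y + w)
    interchange = solve 4 (λ x y z w → x :+ y :+ (z :+ w) := x :+ z :+ (y :+ w)) refl

    expand : ∀ x y z w → (x + y) * (z + w) ≈ x * z + y * w + (x * w + y * z)
    expand = solve 4 (λ x y z w → (x :+ y) :* (z :+ w)
                        := x :* z :+ y :* w :+ (x :* w :+ y :* z)) refl

    eval≈ : ∀ m n → eval (m , n) ≈ m · 1# - n · 1#
    eval≈ m       zero    = sym (trans (+-congˡ -0#≈0#) (+-identityʳ _))
    eval≈ zero    (suc n) = sym (+-identityˡ _)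
    eval≈ (suc m) (suc n) = begin
      eval (m , n)                            ≈⟨ eval≈ m n ⟩
      m · 1# - n · 1#                         ≈⟨ +-identityˡ _ ⟨
      0# + (m · 1# - n · 1#)                  ≈⟨ +-congʳ (-‿inverseʳ 1#) ⟨
      1# - 1# + (m · 1# - n · 1#)             ≈⟨ interchange _ _ _ _ ⟩
      1# + m · 1# + (- 1# - n · 1#)           ≈⟨ +-congˡ (-‿+-comm _ _) ⟩
      1# + m · 1# - (1# + n · 1#)             ≈⟨ +-cong (×-homo-+ 1# 1 m) (-‿cong (×-homo-+ 1# 1 n)) ⟨
      suc m · 1# - suc n · 1#                 ∎

    -x*-y≈x*y : ∀ x y → - x * - y ≈ x * y
    -x*-y≈x*y x y = begin
      - x * - y    ≈⟨ -‿distribˡ-* x (- y) ⟨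
      - (x * - y)  ≈⟨ -‿cong (-‿distribʳ-* x y) ⟨
      - - (x * y)  ≈⟨ -‿involutive (x * y) ⟩
      x * y        ∎

    +-homo : ∀ i j → eval (RawRing._+_ coefficients i j) ≈ eval i + eval j
    +-homo (m , n) (p , q) = begin
      eval (m ℕ.+ p , n ℕ.+ q)                    ≈⟨ eval≈ (m ℕ.+ p) (n ℕ.+ q) ⟩
      (m ℕ.+ p) · 1# - (n ℕ.+ q) · 1#          ≈⟨ +-cong (×-homo-+ 1# m p) (-‿cong (×-homo-+ 1# n q)) ⟩
      m · 1# + p · 1# - (n · 1# + q · 1#)      ≈⟨ +-congˡ (-‿+-comm _ _) ⟨
      m · 1# + p · 1# + (- (n · 1#) - q · 1#)  ≈⟨ interchange _ _ _ _ ⟩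
      m · 1# - n · 1# + (p · 1# - q · 1#)      ≈⟨ +-cong (eval≈ m n) (eval≈ p q) ⟨
      eval (m , n) + eval (p , q)                    ∎

    ·-homo-+* : ∀ m n p q → (m ℕ.* n ℕ.+ p ℕ.* q) · 1# ≈ m · 1# * (n · 1#) + p · 1# * (q · 1#)
    ·-homo-+* m n p q = trans (×-homo-+ 1# (m ℕ.* n) (p ℕ.* q)) (+-cong (×1-homo-* m n) (×1-homo-* p q))

    *-homo : ∀ i j → eval (RawRing._*_ coefficients i j) ≈ eval i * eval j
    *-homo (m , n) (p , q) = begin
      eval (m ℕ.* p ℕ.+ n ℕ.* q , m ℕ.* q ℕ.+ n ℕ.* p)
        ≈⟨ eval≈ (m ℕ.* p ℕ.+ n ℕ.* q) (m ℕ.* q ℕ.+ n ℕ.* p) ⟩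
      (m ℕ.* p ℕ.+ n ℕ.* q) · 1# - (m ℕ.* q ℕ.+ n ℕ.* p) · 1#
        ≈⟨ +-cong (·-homo-+* m p n q) (-‿cong (·-homo-+* m q n p)) ⟩
      M * P + N * Q - (M * Q + N * P)
        ≈⟨ +-congˡ (-‿+-comm _ _) ⟨
      M * P + N * Q + (- (M * Q) - N * P)
        ≈⟨ +-cong (+-congˡ (sym (-x*-y≈x*y N Q))) (+-cong (-‿distribʳ-* M Q) (-‿distribˡ-* N P)) ⟩
      M * P + - N * - Q + (M * - Q + - N * P)
        ≈⟨ expand M (- N) P (- Q) ⟨
      (M - N) * (P - Q)
        ≈⟨ *-cong (eval≈ m n) (eval≈ p q) ⟨
      eval (m , n) * eval (p , q)  ∎
      where
      M = m · 1#
      N = n · 1#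
      P = p · 1#
      Q = q · 1#

    -‿homo : ∀ i → eval (RawRing.-_ coefficients i) ≈ - eval i
    -‿homo (m , n) = begin
      eval (n , m)                ≈⟨ eval≈ n m ⟩
      n · 1# - m · 1#          ≈⟨ +-congʳ (-‿involutive _) ⟨
      - - (n · 1#) - m · 1#    ≈⟨ +-comm _ _ ⟩
      - (m · 1#) - - (n · 1#)  ≈⟨ -‿+-comm _ _ ⟩
      - (m · 1# - n · 1#)      ≈⟨ -‿cong (eval≈ m n) ⟨
      - eval (m , n)              ∎

    homomorphism : coefficients -Raw-AlmostCommutative⟶ fromCommutativeRing R
    homomorphism = record
      { ⟦_⟧    = eval
      ; +-homo = +-homo
      ; *-homo = *-homo
      ; -‿homo = -‿homo
      ; 0-homo = refl
      ; 1-homo = refl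
      }

    -- Coefficients are not kept in reduced form, so a pair such as `(1 , 1)` has to be recognised
    -- as zero by comparing crosswise. This lets the solver drop terms that cancel.
    cross-equal : ∀ m n p q → m ℕ.+ q ≡ p ℕ.+ n → eval (m , n) ≈ eval (p , q)
    cross-equal m n p q eq = x-y≈0⇒x≈y (begin
      eval (m , n) - eval (p , q)    ≈⟨ +-congˡ (-‿homo (p , q)) ⟨
      eval (m , n) + eval (q , p)    ≈⟨ +-homo (m , n) (q , p) ⟨
      eval (m ℕ.+ q , n ℕ.+ p)    ≈⟨ eval≈ (m ℕ.+ q) (n ℕ.+ p) ⟩
      (m ℕ.+ q) · 1# - (n ℕ.+ p) · 1#
        ≡⟨ ≡.cong (λ k → k · 1# - (n ℕ.+ p) · 1#) (≡.trans eq (ℕₚ.+-comm p n)) ⟩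
      (n ℕ.+ p) · 1# - (n ℕ.+ p) · 1#  ≈⟨ -‿inverseʳ _ ⟩
      0#                       ∎)
      where
      x-y≈0⇒x≈y : ∀ {x y} → x - y ≈ 0# → x ≈ y
      x-y≈0⇒x≈y {x} {y} eq = begin
        x            ≈⟨ +-identityʳ x ⟨
        x + 0#       ≈⟨ +-congˡ (-‿inverseˡ y) ⟨
        x + (- y + y)  ≈⟨ +-assoc x (- y) y ⟨
        x - y + y    ≈⟨ +-congʳ eq ⟩
        0# + y       ≈⟨ +-identityˡ y ⟩
        y            ∎

    dec : ∀ i j → Maybe (eval i ≈ eval j)
    dec (m , n) (p , q) = map (cross-equal m n p q) (dec⇒maybe (m ℕ.+ q ℕ.≟ p ℕ.+ n))

  open RingSolver coefficients (fromCommutativeRing R) homomorphism dec public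

-- Inequalities in an ordered field.

module OrderedFieldProperties {a ℓ₁ ℓ₂ : Level} (ℝ : CompleteOrderedField a ℓ₁ ℓ₂) where
  open CompleteOrderedField ℝ
  open Order public using (antisym; total; _≤?_)
    renaming (trans to ≤-trans; reflexive to ≤-reflexive; refl to ≤-refl; _≟_ to _≈?_)
  open SquareRoot ℝ public hiding (√; √-exists)
  open PosetReasoning poset
  open IntegerCoefficients commutativeRing

  -- The pattern behind most estimates below: the difference of the two sides is displayed as a
  -- visibly non-negative expression, and the remaining identity is left to the ring solver.
  ≤-by : ∀ {x y d} → 0# ≤ d → y ≈ x + d → x ≤ y
  ≤-by {x} {y} {d} 0≤d y≈x+d = ≤-trans (x≤x+y x 0≤d) (≤-reflexive (sym y≈x+d))

  x≤y⇒0≤y-x : ∀ {x y} → x ≤ y → 0# ≤ y - x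
  x≤y⇒0≤y-x {x} {y} x≤y with ≤⇒∃+ x≤y
  ... | d , 0≤d , y≈x+d = begin
    0#         ≤⟨ 0≤d ⟩
    d          ≈⟨ solve 2 (λ x d → d := x :+ d :- x) refl x d ⟩
    x + d - x  ≈⟨ +-congʳ y≈x+d ⟨
    y - x      ∎

  +-mono-≤ : ∀ {x y z w} → x ≤ y → z ≤ w → x + z ≤ y + w
  +-mono-≤ {x} {y} {z} {w} x≤y z≤w = begin
    x + z  ≤⟨ +-monoʳ-≤ x z≤w ⟩
    x + w  ≈⟨ +-comm x w ⟩
    w + x  ≤⟨ +-monoʳ-≤ w x≤y ⟩
    w + y  ≈⟨ +-comm w y ⟩
    y + w  ∎

  *-cancelʳ-≤ : ∀ {x y z} → 0# ≤ z → ¬ z ≈ 0# → x * z ≤ y * z → x ≤ y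
  *-cancelʳ-≤ {x} {y} {z} 0≤z z≉0 xz≤yz = begin
    x               ≈⟨ undo x ⟩
    z ⁻¹ * (x * z)  ≤⟨ *-monoˡ-≤-nonNeg (⁻¹-nonNeg 0≤z z≉0) xz≤yz ⟩
    z ⁻¹ * (y * z)  ≈⟨ undo y ⟨
    y               ∎
    where
    undo : ∀ x → x ≈ z ⁻¹ * (x * z)
    undo x = begin-equality
      x               ≈⟨ *-identityʳ x ⟨
      x * 1#          ≈⟨ *-congˡ (⁻¹-inverseʳ z z≉0) ⟨
      x * (z * z ⁻¹)  ≈⟨ solve 3 (λ x z i → x :* (z :* i) := i :* (x :* z)) refl x z (z ⁻¹) ⟩
      z ⁻¹ * (x * z)  ∎

-- Bounds for linear and quadratic forms.

module QuadraticForms {a ℓ₁ ℓ₂ : Level} (ℝ : CompleteOrderedField a ℓ₁ ℓ₂) where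
  open CompleteOrderedField ℝ hiding (zero)
  open OrderedFieldProperties ℝ
  open Spectrum ℝ
  open SemiringSum semiring renaming (sum to ∑ᵛ)
  open PosetReasoning poset
  open IntegerCoefficients commutativeRing

  0≤f⇒0≤∑f : ∀ {n} {f : Vector Carrier n} → (∀ i → 0# ≤ f i) → 0# ≤ ∑ᵛ f
  0≤f⇒0≤∑f {zero}  0≤f = ≤-refl
  0≤f⇒0≤∑f {suc n} 0≤f = +-nonNeg (0≤f zero) (0≤f⇒0≤∑f (0≤f ∘ suc))

  f≤∑f : ∀ {n} {f : Vector Carrier n} → (∀ i → 0# ≤ f i) → ∀ i → f i ≤ ∑ᵛ f
  f≤∑f {suc n} 0≤f zero    = x≤x+y _ (0≤f⇒0≤∑f (0≤f ∘ suc))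
  f≤∑f {suc n} 0≤f (suc i) =
    ≤-trans (f≤∑f (0≤f ∘ suc) i) (≤-by (0≤f zero) (+-comm _ _))

  ∑-mono-≤ : ∀ {n} {f g : Vector Carrier n} → (∀ i → f i ≤ g i) → ∑ᵛ f ≤ ∑ᵛ g
  ∑-mono-≤ {zero}  f≤g = ≤-refl
  ∑-mono-≤ {suc n} f≤g = +-mono-≤ (f≤g zero) (∑-mono-≤ (f≤g ∘ suc))

  infix 8 _∙_
  _∙_ : ∀ {n} → Vector Carrier n → Vector Carrier n → Carrier
  u ∙ v = ∑ᵛ (λ i → u i * v i)

  ∥_∥² : ∀ {n} → Vector Carrier n → Carrier
  ∥ x ∥² = x ∙ x

  form : ∀ {n} → Matrix n → Vector Carrier n → Carrier
  form M x = x ∙ (M *ᵛ x)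

  ∑-linear : ∀ {n} c (f g : Vector Carrier n) → ∑ᵛ (λ i → f i + c * g i) ≈ ∑ᵛ f + c * ∑ᵛ g
  ∑-linear c f g = trans (∑-distrib-+ f (λ i → c * g i)) (+-congˡ (sym (*-distribˡ-sum c g)))

  ∙-zeroʳ : ∀ {n} (u : Vector Carrier n) {v : Vector Carrier n} → (∀ i → v i ≈ 0#) → u ∙ v ≈ 0#
  ∙-zeroʳ {n} u v≈0 = trans (sum-cong-≋ (λ i → trans (*-congˡ (v≈0 i)) (zeroʳ (u i)))) (sum-replicate-zero n)

  0≤∥x∥² : ∀ {n} (x : Vector Carrier n) → 0# ≤ ∥ x ∥²
  0≤∥x∥² x = 0≤f⇒0≤∑f (λ i → 0≤x² (x i))

  ∥x∥²≈0⇒x≈0 : ∀ {n} (x : Vector Carrier n) → ∥ x ∥² ≈ 0# → ∀ i → x i ≈ 0#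
  ∥x∥²≈0⇒x≈0 x ∥x∥²≈0 i =
    x²≈0⇒x≈0 (antisym (≤-trans (f≤∑f (λ j → 0≤x² (x j)) i) (≤-reflexive ∥x∥²≈0)) (0≤x² (x i)))

  -- A crude substitute for Cauchy-Schwarz. The induction uses (a + b)² ≤ 2a² + 2b², so the constant
  -- doubles at each coordinate; only its existence matters.
  ∙-bounded : ∀ {n} (v : Vector Carrier n) →
              ∃ λ K → 0# ≤ K × (∀ y → v ∙ y * v ∙ y ≤ K * ∥ y ∥²)
  ∙-bounded {zero}  v = 0# , ≤-refl , λ y → ≤-reflexive (trans (zeroˡ 0#) (sym (zeroˡ 0#)))
  ∙-bounded {suc n} v with ∙-bounded (v ∘ suc)
  ... | K , 0≤K , bound =
    w * w + w * w + (K + K) , +-nonNeg (double (0≤x² w)) (double 0≤K) , λ y →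
      let z = y zero
          r = v ∘ suc ∙ y ∘ suc
          N = ∥ y ∘ suc ∥²
          0≤N = 0≤∥x∥² (y ∘ suc)
      in ≤-by
        (+-nonNeg (+-nonNeg (0≤x² (w * z - r)) (double (*-nonNeg (0≤x² w) 0≤N)))
                  (+-nonNeg (double (*-nonNeg 0≤K (0≤x² z))) (double (x≤y⇒0≤y-x (bound (y ∘ suc))))))
        (solve 5 (λ w K z r N →
           (w :* w :+ w :* w :+ (K :+ K)) :* (z :* z :+ N) :=
           (w :* z :+ r) :* (w :* z :+ r) :+
             ((w :* z :- r) :* (w :* z :- r) :+ (w :* w :* N :+ w :* w :* N) :+
              (K :* (z :* z) :+ K :* (z :* z) :+ (K :* N :- r :* r :+ (K :* N :- r :* r)))))
           refl w K z r N)
    where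
    w = v zero
    double : ∀ {x} → 0# ≤ x → 0# ≤ x + x
    double 0≤x = +-nonNeg 0≤x 0≤x

  -- Makes the Rayleigh quotients bounded above. Each row contributes a product pq ≤ p² + q², where
  -- q² is bounded by the previous lemma. Since p² + q² - pq = (p - q)² + pq, the case pq ≥ 0 needs
  -- no halves, and the other case is trivial.
  form-bounded : ∀ {n} (M : Matrix n) → ∃ λ K → ∀ x → form M x ≤ K * ∥ x ∥²
  form-bounded {n} M = 1# + ∑ᵛ K , λ x → begin
    form M x
      ≤⟨ ∑-mono-≤ (λ i → term≤ x i) ⟩
    ∑ᵛ (λ i → x i * x i + ∥ x ∥² * K i)
      ≈⟨ ∑-linear ∥ x ∥² (λ i → x i * x i) K ⟩
    ∥ x ∥² + ∥ x ∥² * ∑ᵛ K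
      ≈⟨ solve 2 (λ N K → N :+ N :* K := (con (1 , 0) :+ K) :* N) refl ∥ x ∥² (∑ᵛ K) ⟩
    (1# + ∑ᵛ K) * ∥ x ∥²  ∎
    where
    K : Vector Carrier n
    K i = proj₁ (∙-bounded (M i))

    term≤ : ∀ x i → x i * (M *ᵛ x) i ≤ x i * x i + ∥ x ∥² * K i
    term≤ x i with total 0# (x i * (M *ᵛ x) i)
    ... | inj₁ 0≤pq = ≤-by
      (+-nonNeg (+-nonNeg (0≤x² (p - q)) 0≤pq) (x≤y⇒0≤y-x (proj₂ (proj₂ (∙-bounded (M i))) x)))
      (solve 4 (λ p q N k → p :* p :+ N :* k
                  := p :* q :+ ((p :- q) :* (p :- q) :+ p :* q :+ (k :* N :- q :* q)))
         refl p q ∥ x ∥² (K i))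
      where
      p = x i
      q = (M *ᵛ x) i
    ... | inj₂ pq≤0 = ≤-trans pq≤0
      (+-nonNeg (0≤x² (x i)) (*-nonNeg (0≤∥x∥² x) (proj₁ (proj₂ (∙-bounded (M i))))))

  -- Elimination of one variable and the trichotomy for symmetric matrices.

  Symmetric : ∀ {n} → Matrix n → Set ℓ₁
  Symmetric M = ∀ i j → M i j ≈ M j i

  minor : ∀ {n} → Matrix (suc n) → Matrix n
  minor M i j = M (suc i) (suc j)

  schurComplement : ∀ {n} → Matrix (suc n) → Matrix n
  schurComplement M i j = M (suc i) (suc j) + - (M zero zero ⁻¹ * M zero (suc i)) * M zero (suc j)

  module _ {n} (M : Matrix (suc n)) (M-sym : Symmetric M) where
    private
      m = M zero zero
      v = M zero ∘ suc

    *ᵛ-minor : ∀ x i → (M *ᵛ x) (suc i) ≈ (minor M *ᵛ x ∘ suc) i + x zero * v i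
    *ᵛ-minor x i = begin-equality
      M (suc i) zero * x zero + (minor M *ᵛ x ∘ suc) i  ≈⟨ +-comm _ _ ⟩
      (minor M *ᵛ x ∘ suc) i + M (suc i) zero * x zero  ≈⟨ +-congˡ (*-comm _ _) ⟩
      (minor M *ᵛ x ∘ suc) i + x zero * M (suc i) zero  ≈⟨ +-congˡ (*-congˡ (M-sym (suc i) zero)) ⟩
      (minor M *ᵛ x ∘ suc) i + x zero * v i             ∎

    *ᵛ-schur : ∀ y i → (schurComplement M *ᵛ y) i ≈ (minor M *ᵛ y) i + - (m ⁻¹ * v i) * v ∙ y
    *ᵛ-schur y i = trans
      (sum-cong-≋ λ j → trans (distribʳ (y j) (M (suc i) (suc j)) (- (m ⁻¹ * v i) * v j))
                              (+-congˡ (*-assoc _ (v j) (y j))))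
      (∑-linear {n} (- (m ⁻¹ * v i)) _ _)

    form-minor : ∀ x → form M x ≈ m * (x zero * x zero) + (x zero + x zero) * v ∙ x ∘ suc
                                  + form (minor M) (x ∘ suc)
    form-minor x = begin-equality
      s * (m * s + p) + y ∙ ((M *ᵛ x) ∘ suc)
        ≈⟨ +-congˡ (sum-cong-≋ λ i → trans (*-congˡ (*ᵛ-minor x i)) (regroup (y i) _ s (v i))) ⟩
      s * (m * s + p) + ∑ᵛ (λ i → y i * (minor M *ᵛ y) i + s * (v i * y i))
        ≈⟨ +-congˡ (∑-linear {n} s _ _) ⟩
      s * (m * s + p) + (form (minor M) y + s * p)
        ≈⟨ solve 4 (λ s m p f → s :* (m :* s :+ p) :+ (f :+ s :* p)
                      := m :* (s :* s) :+ (s :+ s) :* p :+ f) refl s m p (form (minor M) y) ⟩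
      m * (s * s) + (s + s) * p + form (minor M) y  ∎
      where
      s = x zero
      y = x ∘ suc
      p = v ∙ y
      regroup : ∀ y w s v → y * (w + s * v) ≈ y * w + s * (v * y)
      regroup = solve 4 (λ y w s v → y :* (w :+ s :* v) := y :* w :+ s :* (v :* y)) refl

    form-schur : ∀ y → form (schurComplement M) y ≈ form (minor M) y - m ⁻¹ * (v ∙ y * v ∙ y)
    form-schur y = begin-equality
      form (schurComplement M) y
        ≈⟨ sum-cong-≋ (λ i → trans (*-congˡ (*ᵛ-schur y i)) (regroup (y i) _ (m ⁻¹) (v i) p)) ⟩
      ∑ᵛ (λ i → y i * (minor M *ᵛ y) i + - (m ⁻¹ * p) * (v i * y i))
        ≈⟨ ∑-linear {n} (- (m ⁻¹ * p)) _ _ ⟩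
      form (minor M) y + - (m ⁻¹ * p) * p
        ≈⟨ solve 3 (λ f i p → f :+ :- (i :* p) :* p := f :- i :* (p :* p)) refl _ (m ⁻¹) p ⟩
      form (minor M) y - m ⁻¹ * (p * p)  ∎
      where
      p = v ∙ y
      regroup : ∀ y w i v p → y * (w + - (i * v) * p) ≈ y * w + - (i * p) * (v * y)
      regroup = solve 5 (λ y w i v p → y :* (w :+ :- (i :* v) :* p)
                           := y :* w :+ :- (i :* p) :* (v :* y)) refl

    -- One step of Lagrange's reduction to a sum of squares. As `u` and the remaining coordinates
    -- determine `x`, questions about the sign of the form pass to the smaller matrix.
    complete-square : ¬ m ≈ 0# → ∀ x → let u = x zero + m ⁻¹ * v ∙ x ∘ suc in
                      form M x ≈ m * (u * u) + form (schurComplement M) (x ∘ suc)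
    complete-square m≉0 x = begin-equality
      form M x
        ≈⟨ form-minor x ⟩
      m * (s * s) + (s + s) * p + f
        -- The relation between `m` and its inverse `i` is unknown to the solver, so a factor `1#`
        -- is made visible. The next step adds and subtracts `1# * i * (p * p)`, after which `1#`
        -- becomes `m * i` wherever the square needs it.
        ≈⟨ solve 4 (λ m s p f → m :* (s :* s) :+ (s :+ s) :* p :+ f
                      := m :* (s :* s) :+ con (1 , 0) :* ((s :+ s) :* p) :+ f) refl m s p f ⟩
      m * (s * s) + 1# * ((s + s) * p) + f
        ≈⟨ solve 6 (λ m s p f i o → m :* (s :* s) :+ o :* ((s :+ s) :* p) :+ f
                      := m :* (s :* s) :+ o :* ((s :+ s) :* p) :+ o :* i :* (p :* p)
                         :+ (f :- o :* i :* (p :* p))) refl m s p f i 1# ⟩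
      m * (s * s) + 1# * ((s + s) * p) + 1# * i * (p * p) + (f - 1# * i * (p * p))
        ≈⟨ +-cong (+-cong (+-congˡ (*-congʳ 1≈mi)) (*-congʳ (*-congʳ 1≈mi)))
                  (+-congˡ (-‿cong (*-congʳ (*-identityˡ i)))) ⟩
      m * (s * s) + m * i * ((s + s) * p) + m * i * i * (p * p) + (f - i * (p * p))
        ≈⟨ solve 5 (λ m s p f i →
             m :* (s :* s) :+ m :* i :* ((s :+ s) :* p) :+ m :* i :* i :* (p :* p)
               :+ (f :- i :* (p :* p)) :=
             m :* ((s :+ i :* p) :* (s :+ i :* p)) :+ (f :- i :* (p :* p))) refl m s p f i ⟩
      m * ((s + i * p) * (s + i * p)) + (f - i * (p * p))
        ≈⟨ +-congˡ (form-schur y) ⟨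
      m * ((s + i * p) * (s + i * p)) + form (schurComplement M) y  ∎
      where
      s = x zero
      y = x ∘ suc
      p = v ∙ y
      i = m ⁻¹
      f = form (minor M) y
      1≈mi : 1# ≈ m * i
      1≈mi = sym (⁻¹-inverseʳ m m≉0)

  -- Positive definiteness carries a uniform constant `B`: positivity at each non-zero vector
  -- separately would not give the gap by which a supremum can be lowered. `indefinite` means only
  -- that a negative value occurs, so it may overlap with `singular`.
  data Definiteness {n} (M : Matrix n) : Set (a ⊔ ℓ₁ ⊔ ℓ₂) where
    coercive   : ∀ B → 0# ≤ B → (∀ x → 0# ≤ form M x) → (∀ x → ∥ x ∥² ≤ B * form M x) → Definiteness M
    singular   : ∀ x → ¬ (∀ i → x i ≈ 0#) → (∀ i → (M *ᵛ x) i ≈ 0#) → Definiteness M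
    indefinite : ∀ x → ¬ 0# ≤ form M x → Definiteness M

  e₀ : ∀ {n} → Vector Carrier (suc n)
  e₀ = 1# ∷ replicate _ 0#

  *ᵛ-e₀ : ∀ {n} (M : Matrix (suc n)) i → (M *ᵛ e₀) i ≈ M i zero
  *ᵛ-e₀ M i = trans (+-cong (*-identityʳ _) (∙-zeroʳ (M i ∘ suc) (λ _ → refl))) (+-identityʳ _)

  form-e₀ : ∀ {n} (M : Matrix (suc n)) → form M e₀ ≈ M zero zero
  form-e₀ M = begin-equality
    1# * (M *ᵛ e₀) zero + replicate _ 0# ∙ ((M *ᵛ e₀) ∘ suc)
      ≈⟨ +-cong (*-identityˡ _) (sum-cong-≋ (λ i → *-comm 0# ((M *ᵛ e₀) (suc i)))) ⟩
    (M *ᵛ e₀) zero + ((M *ᵛ e₀) ∘ suc) ∙ replicate _ 0#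
      ≈⟨ +-cong (*ᵛ-e₀ M zero) (∙-zeroʳ ((M *ᵛ e₀) ∘ suc) (λ _ → refl)) ⟩
    M zero zero + 0#
      ≈⟨ +-identityʳ _ ⟩
    M zero zero  ∎

  schurComplement-sym : ∀ {n} (M : Matrix (suc n)) → Symmetric M → Symmetric (schurComplement M)
  schurComplement-sym M M-sym i j = +-cong (M-sym (suc i) (suc j))
    (solve 3 (λ k x y → :- (k :* x) :* y := :- (k :* y) :* x) refl _ _ _)

  module _ {n} (M : Matrix (suc n)) (M-sym : Symmetric M) where
    private
      m = M zero zero
      v = M zero ∘ suc

    -- If the rest of the first row vanishes, `e₀` lies in the kernel. Otherwise the form at `s ∷ v`
    -- is affine in `s` with slope 2 ∥v∥², and `s` is chosen to give the value -1.
    definite-zeroPivot : m ≈ 0# → Definiteness M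
    definite-zeroPivot m≈0 with ∥ v ∥² ≈? 0#
    ... | yes ∥v∥²≈0 = singular e₀ (λ e₀≈0 → 1≉0 (e₀≈0 zero)) λ
      { zero    → trans (*ᵛ-e₀ M zero) m≈0
      ; (suc i) → trans (*ᵛ-e₀ M (suc i)) (trans (M-sym (suc i) zero) (∥x∥²≈0⇒x≈0 v ∥v∥²≈0 i))
      }
    ... | no ∥v∥²≉0 = indefinite (s ∷ v) λ 0≤form → 1≰0 (begin
      1#                ≤⟨ ≤-by 0≤form refl ⟩
      1# + form M (s ∷ v)  ≈⟨ +-congˡ (form-minor M M-sym (s ∷ v)) ⟩
      1# + (m * (s * s) + (s + s) * V + f)
        ≈⟨ +-congˡ (+-congʳ (+-congʳ (trans (*-congʳ m≈0) (zeroˡ _)))) ⟩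
      1# + (0# + (s + s) * V + f)
        ≈⟨ solve 3 (λ f V h → con (1 , 0) :+ (con (0 , 0) :+
                      (:- ((f :+ con (1 , 0)) :* h) :+ :- ((f :+ con (1 , 0)) :* h)) :* V :+ f)
                    := (f :+ con (1 , 0)) :* (con (1 , 0) :- (V :+ V) :* h)) refl f V h ⟩
      (f + 1#) * (1# - (V + V) * h)  ≈⟨ *-congˡ (+-congˡ (-‿cong (⁻¹-inverseʳ (V + V) V+V≉0))) ⟩
      (f + 1#) * (1# - 1#)           ≈⟨ solve 1 (λ f → (f :+ con (1 , 0)) :* (con (1 , 0) :- con (1 , 0))
                                                     := con (0 , 0)) refl f ⟩
      0#                             ∎)
      where
      V = ∥ v ∥²
      f = form (minor M) v
      h = (V + V) ⁻¹
      s = - ((f + 1#) * h)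
      V+V≉0 : ¬ V + V ≈ 0#
      V+V≉0 V+V≈0 = ∥v∥²≉0 (antisym (≤-trans (x≤x+y V (0≤∥x∥² v)) (≤-reflexive V+V≈0)) (0≤∥x∥² v))

    definite-negativePivot : ¬ m ≈ 0# → m ≤ 0# → Definiteness M
    definite-negativePivot m≉0 m≤0 = indefinite e₀ λ 0≤form →
      m≉0 (antisym m≤0 (≤-trans 0≤form (≤-reflexive (form-e₀ M))))

    definite-positivePivot : ¬ m ≈ 0# → 0# ≤ m → Definiteness (schurComplement M) → Definiteness M
    definite-positivePivot m≉0 0≤m (coercive B 0≤B 0≤form ∥∥²≤form) =
      -- From s = u - i p follows s² ≤ 2u² + 2i²p², and p² ≤ K N. Hence s² + N ≤ 2i (m u²) + L N
      -- with L = 2i²K + 1, and N ≤ B f turns this into a multiple of the form m u² + f.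
      coercive (i + i + L * B) (+-nonNeg 0≤2i (*-nonNeg 0≤L 0≤B)) 0≤form′ ∥∥²≤form′
      where
      i = m ⁻¹
      0≤i : 0# ≤ i
      0≤i = ⁻¹-nonNeg 0≤m m≉0
      0≤2i : 0# ≤ i + i
      0≤2i = +-nonNeg 0≤i 0≤i
      K = proj₁ (∙-bounded v)
      0≤K : 0# ≤ K
      0≤K = proj₁ (proj₂ (∙-bounded v))
      L = (i + i) * i * K + 1#
      0≤L : 0# ≤ L
      0≤L = +-nonNeg (*-nonNeg (*-nonNeg 0≤2i 0≤i) 0≤K) 0≤1
      u : Vector Carrier (suc n) → Carrier
      u x = x zero + i * v ∙ x ∘ suc
      0≤mu²  : ∀ x → 0# ≤ m * (u x * u x)
      0≤mu² x = *-nonNeg 0≤m (0≤x² (u x))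
      0≤form′ : ∀ x → 0# ≤ form M x
      0≤form′ x = ≤-trans (+-nonNeg (0≤mu² x) (0≤form (x ∘ suc)))
                          (≤-reflexive (sym (complete-square M M-sym m≉0 x)))

      ∥∥²≤form′ : ∀ x → ∥ x ∥² ≤ (i + i + L * B) * form M x
      ∥∥²≤form′ x = begin
        s * s + N
          ≤⟨ ≤-by (+-nonNeg (+-nonNeg (*-nonNeg 0≤2i (0≤form y))
                                      (*-nonNeg (*-nonNeg 0≤L 0≤B) (0≤mu² x)))
                    (+-nonNeg (*-nonNeg 0≤L (x≤y⇒0≤y-x (∥∥²≤form y)))
                      (+-nonNeg (*-nonNeg (*-nonNeg 0≤2i 0≤i) (x≤y⇒0≤y-x (proj₂ (proj₂ (∙-bounded v)) y)))
                                (0≤x² (u x + i * p)))))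
                  (solve 8 (λ s N f K B i m p →
                     let L = (i :+ i) :* i :* K :+ con (1 , 0)
                         u = s :+ i :* p
                     in con (1 , 0) :* (u :* u :+ u :* u) :+ ((i :+ i) :* f :+ L :* B :* (m :* (u :* u) :+ f)) :=
                        s :* s :+ N :+
                        ((i :+ i) :* f :+ L :* B :* (m :* (u :* u)) :+
                         (L :* (B :* f :- N) :+
                          ((i :+ i) :* i :* (K :* N :- p :* p) :+ (u :+ i :* p) :* (u :+ i :* p)))))
                     refl s N f K B i m p) ⟩
        1# * (u x * u x + u x * u x) + ((i + i) * f + L * B * (m * (u x * u x) + f))
          ≈⟨ +-congʳ (*-congʳ (⁻¹-inverseʳ m m≉0)) ⟨
        m * i * (u x * u x + u x * u x) + ((i + i) * f + L * B * (m * (u x * u x) + f))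
          ≈⟨ solve 5 (λ m i u f LC →
               m :* i :* (u :* u :+ u :* u) :+ ((i :+ i) :* f :+ LC :* (m :* (u :* u) :+ f)) :=
               (i :+ i :+ LC) :* (m :* (u :* u) :+ f)) refl m i (u x) f (L * B) ⟩
        (i + i + L * B) * (m * (u x * u x) + f)
          ≈⟨ *-congˡ (complete-square M M-sym m≉0 x) ⟨
        (i + i + L * B) * form M x  ∎
        where
        s = x zero
        y = x ∘ suc
        N = ∥ y ∥²
        p = v ∙ y
        f = form (schurComplement M) y
    definite-positivePivot m≉0 0≤m (singular y y≉0 Sy≈0) =
      -- The new coordinate annihilates the completed square, so only the Schur complement remains.
      -- The indefinite case uses the same lift.
      singular (- (m ⁻¹ * v ∙ y) ∷ y) (λ x≈0 → y≉0 (x≈0 ∘ suc)) λ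
      { zero    → begin-equality
          m * - (m ⁻¹ * v ∙ y) + v ∙ y
            ≈⟨ solve 3 (λ m i p → m :* :- (i :* p) :+ p := (con (1 , 0) :- m :* i) :* p) refl m (m ⁻¹) _ ⟩
          (1# - m * m ⁻¹) * v ∙ y
            ≈⟨ *-congʳ (trans (+-congˡ (-‿cong (⁻¹-inverseʳ m m≉0))) (-‿inverseʳ 1#)) ⟩
          0# * v ∙ y
            ≈⟨ zeroˡ _ ⟩
          0#  ∎
      ; (suc j) → begin-equality
          (M *ᵛ (- (m ⁻¹ * v ∙ y) ∷ y)) (suc j)
            ≈⟨ *ᵛ-minor M M-sym (- (m ⁻¹ * v ∙ y) ∷ y) j ⟩
          (minor M *ᵛ y) j + - (m ⁻¹ * v ∙ y) * v j
            ≈⟨ +-congˡ (solve 3 (λ i p w → :- (i :* p) :* w := :- (i :* w) :* p) refl (m ⁻¹) _ (v j)) ⟩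
          (minor M *ᵛ y) j + - (m ⁻¹ * v j) * v ∙ y
            ≈⟨ *ᵛ-schur M M-sym y j ⟨
          (schurComplement M *ᵛ y) j
            ≈⟨ Sy≈0 j ⟩
          0#  ∎
      }
    definite-positivePivot m≉0 0≤m (indefinite y 0≰form) =
      indefinite (- (m ⁻¹ * v ∙ y) ∷ y) λ 0≤form → 0≰form (begin
        0#
          ≤⟨ 0≤form ⟩
        form M (- (m ⁻¹ * v ∙ y) ∷ y)
          ≈⟨ complete-square M M-sym m≉0 (- q ∷ y) ⟩
        m * ((- q + q) * (- q + q)) + form (schurComplement M) y
          ≈⟨ solve 3 (λ m q f → m :* ((:- q :+ q) :* (:- q :+ q)) :+ f := f) refl m q _ ⟩
        form (schurComplement M) y  ∎)
      where
      q = m ⁻¹ * v ∙ y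

  -- Elimination without exchanging rows: a zero or negative pivot decides the matter at once, and
  -- only a positive one calls for recursion.
  definiteness : ∀ {n} (M : Matrix n) → Symmetric M → Definiteness M
  definiteness {zero}  M M-sym =
    coercive 0# ≤-refl (λ _ → ≤-refl) (λ _ → ≤-reflexive (sym (zeroˡ _)))
  definiteness {suc n} M M-sym with M zero zero ≈? 0# | total 0# (M zero zero)
  ... | yes m≈0 | _        = definite-zeroPivot M M-sym m≈0
  ... | no  m≉0 | inj₂ m≤0 = definite-negativePivot M M-sym m≉0 m≤0
  ... | no  m≉0 | inj₁ 0≤m = definite-positivePivot M M-sym m≉0 0≤m
    (definiteness (schurComplement M) (schurComplement-sym M M-sym))

-- The supremum of the Rayleigh quotients is an eigenvalue.

module RayleighPrinciple {a ℓ₁ ℓ₂ : Level} (ℝ : CompleteOrderedField a ℓ₁ ℓ₂) where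
  open CompleteOrderedField ℝ hiding (zero)
  open OrderedFieldProperties ℝ
  open QuadraticForms ℝ
  open Spectrum ℝ
  open SemiringSum semiring renaming (sum to ∑ᵛ)
  open PosetReasoning poset
  open IntegerCoefficients commutativeRing

  δ : ∀ {n} → Matrix n
  δ zero    zero    = 1#
  δ zero    (suc j) = 0#
  δ (suc i) zero    = 0#
  δ (suc i) (suc j) = δ i j

  δ-sym : ∀ {n} → Symmetric (δ {n})
  δ-sym zero    zero    = refl
  δ-sym zero    (suc j) = refl
  δ-sym (suc i) zero    = refl
  δ-sym (suc i) (suc j) = δ-sym i j

  δ-*ᵛ : ∀ {n} (x : Vector Carrier n) i → (δ *ᵛ x) i ≈ x i
  δ-*ᵛ {suc n} x zero = begin-equality
    1# * x zero + replicate _ 0# ∙ (x ∘ suc)  ≈⟨ +-cong (*-identityˡ _) (sum-cong-≋ (λ j → *-comm 0# (x (suc j)))) ⟩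
    x zero + (x ∘ suc) ∙ replicate _ 0#       ≈⟨ +-congˡ (∙-zeroʳ (x ∘ suc) (λ _ → refl)) ⟩
    x zero + 0#                               ≈⟨ +-identityʳ _ ⟩
    x zero                                    ∎
  δ-*ᵛ x (suc i) = trans (+-cong (zeroˡ _) (δ-*ᵛ (x ∘ suc) i)) (+-identityˡ _)

  ∑-combination : ∀ {n} c (f g : Vector Carrier n) →
                  ∑ᵛ (λ i → c * f i - g i) ≈ c * ∑ᵛ f - ∑ᵛ g
  ∑-combination {n} c f g = begin-equality
    ∑ᵛ (λ i → c * f i - g i)
      ≈⟨ sum-cong-≋ (λ i → negate (c * f i) (g i)) ⟩
    ∑ᵛ (λ i → c * f i + - 1# * g i)
      ≈⟨ ∑-linear (- 1#) (λ i → c * f i) g ⟩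
    ∑ᵛ (λ i → c * f i) + - 1# * ∑ᵛ g
      ≈⟨ +-congʳ (*-distribˡ-sum c f) ⟨
    c * ∑ᵛ f + - 1# * ∑ᵛ g
      ≈⟨ negate (c * ∑ᵛ f) (∑ᵛ g) ⟨
    c * ∑ᵛ f - ∑ᵛ g  ∎
    where
    negate : ∀ x y → x - y ≈ x + - 1# * y
    negate = solve 2 (λ x y → x :- y := x :+ :- con (1 , 0) :* y) refl

  -- The matrix t I - A itself, not its inverse, to which the name usually refers.
  resolvent : ∀ {n} → Matrix n → Carrier → Matrix n
  resolvent A t i j = t * δ i j - A i j

  resolvent-sym : ∀ {n} {A : Matrix n} → Symmetric A → ∀ t → Symmetric (resolvent A t)
  resolvent-sym A-sym t i j = +-cong (*-congˡ (δ-sym i j)) (-‿cong (A-sym i j))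

  resolvent-*ᵛ : ∀ {n} (A : Matrix n) t x i → (resolvent A t *ᵛ x) i ≈ t * x i - (A *ᵛ x) i
  resolvent-*ᵛ {n} A t x i = begin-equality
    ∑ᵛ (λ j → (t * δ i j - A i j) * x j)
      ≈⟨ sum-cong-≋ (λ j → expand t (δ i j) (A i j) (x j)) ⟩
    ∑ᵛ (λ j → t * (δ i j * x j) - A i j * x j)
      ≈⟨ ∑-combination {n} t _ _ ⟩
    t * (δ *ᵛ x) i - (A *ᵛ x) i
      ≈⟨ +-congʳ (*-congˡ (δ-*ᵛ x i)) ⟩
    t * x i - (A *ᵛ x) i  ∎
    where
    expand : ∀ t d a x → (t * d - a) * x ≈ t * (d * x) - a * x
    expand = solve 4 (λ t d a x → (t :* d :- a) :* x := t :* (d :* x) :- a :* x) refl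

  form-resolvent : ∀ {n} (A : Matrix n) t x → form (resolvent A t) x ≈ t * ∥ x ∥² - form A x
  form-resolvent {n} A t x = begin-equality
    ∑ᵛ (λ i → x i * (resolvent A t *ᵛ x) i)
      ≈⟨ sum-cong-≋ (λ i → trans (*-congˡ (resolvent-*ᵛ A t x i)) (expand (x i) t _)) ⟩
    ∑ᵛ (λ i → t * (x i * x i) - x i * (A *ᵛ x) i)
      ≈⟨ ∑-combination {n} t _ _ ⟩
    t * ∥ x ∥² - form A x  ∎
    where
    expand : ∀ x t y → x * (t * x - y) ≈ t * (x * x) - x * y
    expand = solve 3 (λ x t y → x :* (t :* x :- y) := t :* (x :* x) :- x :* y) refl

  -- All numbers lying below some Rayleigh quotient. They have the same supremum as the quotients,
  -- and the inequality avoids division by the squared norm.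
  RayleighBound : ∀ {n} → Matrix n → Carrier → Set (a ⊔ ℓ₁ ⊔ ℓ₂)
  RayleighBound A t = ∃ λ x → ¬ ∥ x ∥² ≈ 0# × t * ∥ x ∥² ≤ form A x

  rayleighBounds-bounded : ∀ {n} (A : Matrix n) r → RayleighBound A r → r ≤ proj₁ (form-bounded A)
  rayleighBounds-bounded A r (x , N≉0 , r≤) =
    *-cancelʳ-≤ (0≤∥x∥² x) N≉0 (≤-trans r≤ (proj₂ (form-bounded A) x))

  module _ {n} (A : Matrix n) (A-sym : Symmetric A) {s}
           (upper : ∀ r → RayleighBound A r → r ≤ s)
           (least : ∀ b → (∀ r → RayleighBound A r → r ≤ b) → s ≤ b) where

    form≤s : ∀ x → form A x ≤ s * ∥ x ∥²
    form≤s x with ∥ x ∥² ≈? 0#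
    ... | yes N≈0 = begin
      form A x    ≤⟨ proj₂ (form-bounded A) x ⟩
      proj₁ (form-bounded A) * ∥ x ∥²  ≈⟨ trans (*-congˡ N≈0) (zeroʳ _) ⟩
      0#          ≈⟨ trans (*-congˡ N≈0) (zeroʳ s) ⟨
      s * ∥ x ∥²  ∎
    ... | no N≉0 = begin
      form A x  ≈⟨ quotient ⟨
      r * N     ≈⟨ *-comm r N ⟩
      N * r     ≤⟨ *-monoˡ-≤-nonNeg (0≤∥x∥² x) (upper r (x , N≉0 , ≤-reflexive quotient)) ⟩
      N * s     ≈⟨ *-comm N s ⟩
      s * N     ∎
      where
      N = ∥ x ∥²
      r = form A x * N ⁻¹
      quotient : r * N ≈ form A x
      quotient = begin-equality
        form A x * N ⁻¹ * N    ≈⟨ solve 3 (λ f i n → f :* i :* n := f :* (n :* i)) refl (form A x) (N ⁻¹) N ⟩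
        form A x * (N * N ⁻¹)  ≈⟨ *-congˡ (⁻¹-inverseʳ N N≉0) ⟩
        form A x * 1#          ≈⟨ *-identityʳ _ ⟩
        form A x               ∎

    -- At the supremum of the Rayleigh quotients the resolvent is neither coercive
    -- (a smaller upper bound would do) nor indefinite.
    supremum-eigenvector : Definiteness (resolvent A s) →
                  ∃ λ x → ¬ (∀ i → x i ≈ 0#) × (∀ i → (A *ᵛ x) i ≈ s * x i)
    supremum-eigenvector (singular x x≉0 Rx≈0) = x , x≉0 , λ i → begin-equality
      (A *ᵛ x) i
        ≈⟨ solve 2 (λ p q → q := p :- (p :- q)) refl (s * x i) ((A *ᵛ x) i) ⟩
      s * x i - (s * x i - (A *ᵛ x) i)
        ≈⟨ +-congˡ (-‿cong (trans (sym (resolvent-*ᵛ A s x i)) (Rx≈0 i))) ⟩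
      s * x i - 0#
        ≈⟨ solve 1 (λ p → p :- con (0 , 0) := p) refl (s * x i) ⟩
      s * x i  ∎
    supremum-eigenvector (indefinite x 0≰form) = contradiction
      (≤-trans (x≤y⇒0≤y-x (form≤s x)) (≤-reflexive (sym (form-resolvent A s x)))) 0≰form
    supremum-eigenvector (coercive B 0≤B 0≤form ∥∥²≤form) = contradiction 1≤0 1≰0
      where
      -- The inverse `h` of `D` is the amount by which `s` can be lowered: N ≤ B g gives h N ≤ h (1
      -- + B) g = g = s N - form A x. The summand 1 keeps `D` invertible when `B` is zero.
      D = 1# + B
      0≤D : 0# ≤ D
      0≤D = +-nonNeg 0≤1 0≤B
      D≉0 : ¬ D ≈ 0#
      D≉0 D≈0 = 1≰0 (≤-trans (x≤x+y 1# 0≤B) (≤-reflexive D≈0))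
      h = D ⁻¹

      shrink : ∀ r → RayleighBound A r → r ≤ s - h
      shrink r (x , N≉0 , rN≤) = *-cancelʳ-≤ (0≤∥x∥² x) N≉0 (begin
        r * N
          ≤⟨ ≤-by (+-nonNeg (x≤y⇒0≤y-x rN≤) (*-nonNeg (⁻¹-nonNeg 0≤D D≉0)
                    (+-nonNeg (0≤form x) (x≤y⇒0≤y-x (∥∥²≤form x)))))
                  (solve 7 (λ r N f g h B o →
                     f :+ h :* (g :+ B :* g :- N) := r :* N :+ (f :- r :* N :+ h :* (g :+ (B :* g :- N))))
                     refl r N (form A x) (form (resolvent A s) x) h B 1#) ⟩
        form A x + h * (g + B * g - N)
          ≈⟨ solve 5 (λ f h g B N → f :+ h :* (g :+ B :* g :- N)
               := f :+ (con (1 , 0) :+ B) :* h :* g :- h :* N) refl (form A x) h g B N ⟩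
        form A x + D * h * g - h * N
          ≈⟨ +-congʳ (+-congˡ (*-cong (⁻¹-inverseʳ D D≉0) (form-resolvent A s x))) ⟩
        form A x + 1# * (s * N - form A x) - h * N
          ≈⟨ solve 4 (λ f s N h → f :+ con (1 , 0) :* (s :* N :- f) :- h :* N := (s :- h) :* N)
               refl (form A x) s N h ⟩
        (s - h) * N  ∎)
        where
        N = ∥ x ∥²
        g = form (resolvent A s) x

      1≤0 : 1# ≤ 0#
      1≤0 = begin
        1#      ≈⟨ ⁻¹-inverseʳ D D≉0 ⟨
        D * h   ≤⟨ *-monoˡ-≤-nonNeg 0≤D h≤0 ⟩
        D * 0#  ≈⟨ zeroʳ D ⟩
        0#      ∎
        where
        h≤0 : h ≤ 0#
        h≤0 = begin
          h            ≈⟨ solve 2 (λ s h → h := s :- (s :- h)) refl s h ⟩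
          s - (s - h)  ≤⟨ ≤-by (x≤y⇒0≤y-x (least (s - h) shrink))
                            (solve 2 (λ s h → con (0 , 0) := s :- (s :- h) :+ (s :- h :- s)) refl s h) ⟩
          0#           ∎

  rayleigh : ∀ {n} (A : Matrix n) → Symmetric A → ∀ t → RayleighBound A t →
             ∃ λ ev → t ≤ ev ×
             ∃ λ x → ¬ (∀ i → x i ≈ 0#) × (∀ i → (A *ᵛ x) i ≈ ev * x i)
  rayleigh A A-sym t t∈
    with supremum (RayleighBound A) (t , t∈) (_ , rayleighBounds-bounded A)
  ... | s , upper , least =
    s , upper t t∈ , supremum-eigenvector A A-sym upper least (definiteness _ (resolvent-sym A-sym s))

  √-spec : ∀ {x} → 0# ≤ x → 0# ≤ √ x × √ x * √ x ≈ x
  √-spec {x} 0≤x with 0# ≤? x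
  ... | yes p  = proj₂ (SquareRoot.√-exists ℝ x p)
  ... | no 0≰x = contradiction 0≤x 0≰x

  -- The real eigenvalue `ev` is read as the complex eigenvalue `ev` + 0i, with an eigenvector of
  -- zero imaginary part. Its modulus is the root of `ev * ev`, which is at least `ev` whatever the
  -- sign of `ev`.
  rayleigh≤spectralRadius : ∀ {n} {A : Matrix n} → Symmetric A → ∀ {ρ} → IsSpectralRadius A ρ →
                            ∀ {t} → RayleighBound A t → t ≤ ρ
  rayleigh≤spectralRadius {A = A} A-sym {ρ} (_ , maximal) {t} t∈ with rayleigh A A-sym t t∈
  ... | ev , t≤ev , x , x≉0 , Ax≈ = begin
    t              ≤⟨ t≤ev ⟩
    ev             ≤⟨ x²≤y²⇒x≤y (proj₁ (√-spec 0≤ev²)) (begin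
      ev * ev              ≈⟨ solve 1 (λ e → e :* e := e :* e :+ con (0 , 0) :* con (0 , 0)) refl ev ⟩
      ev * ev + 0# * 0#    ≈⟨ proj₂ (√-spec 0≤ev²) ⟨
      modulus ev 0# * modulus ev 0#  ∎) ⟩
    modulus ev 0#  ≤⟨ maximal ev 0# (x , (λ _ → 0#) , (λ 0≈ → x≉0 (proj₁ ∘ 0≈)) ,
                        (λ i → trans (Ax≈ i) (solve 2 (λ e x → e :* x := e :* x :- con (0 , 0) :* con (0 , 0))
                                               refl ev (x i))) ,
                        (λ i → trans (∙-zeroʳ (A i) (λ _ → refl))
                                 (solve 2 (λ e x → con (0 , 0) := e :* con (0 , 0) :+ con (0 , 0) :* x)
                                   refl ev (x i)))) ⟩
    ρ              ∎
    where
    0≤ev² : 0# ≤ ev * ev + 0# * 0#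
    0≤ev² = +-nonNeg (0≤x² ev) (0≤x² 0#)

-- The quadratic form of a threshold adjacency pattern.

module ThresholdForms {a ℓ₁ ℓ₂ : Level} (ℝ : CompleteOrderedField a ℓ₁ ℓ₂) where
  open CompleteOrderedField ℝ hiding (zero)
  open OrderedFieldProperties ℝ
  open QuadraticForms ℝ
  open Spectrum ℝ
  open SemiringSum semiring renaming (sum to ∑ᵛ)
  open SemiringMult semiring using (×-homo-+; ×1-homo-*)
  open PosetReasoning poset
  open IntegerCoefficients commutativeRing

  ind : Bool → Carrier
  ind b = if b then 1# else 0#

  0≤ind : ∀ b → 0# ≤ ind b
  0≤ind true  = 0≤1
  0≤ind false = ≤-refl

  ind-∧ : ∀ b c → ind (b ∧ c) ≈ ind b * ind c
  ind-∧ true  c = sym (*-identityˡ _)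
  ind-∧ false c = sym (zeroˡ _)

  -- The function `f` is arbitrary because the tail of `allFin` is a `tabulate` of successors, not a
  -- smaller `allFin`.
  fromℕ-count : ∀ {b} {X : Set b} (p : X → Bool) {n} (f : Fin n → X) →
                fromℕ (length (filterᵇ p (tabulate f))) ≈ ∑ᵛ (λ i → ind (p (f i)))
  fromℕ-count p {zero}  f = refl
  fromℕ-count p {suc n} f with p (f zero)
  ... | true  = +-congˡ (fromℕ-count p (f ∘ suc))
  ... | false = trans (fromℕ-count p (f ∘ suc)) (sym (+-identityˡ _))

  fromℕ-sumOfSquares : ∀ {b} {X : Set b} (p : X → Bool) (g : X → ℕ) {n} (f : Fin n → X) →
    fromℕ (ListAction.sum (List.map (ℕ._^ 2) (List.map g (filterᵇ p (tabulate f))))) ≈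
    ∑ᵛ (λ i → ind (p (f i)) * (fromℕ (g (f i)) * fromℕ (g (f i))))
  fromℕ-sumOfSquares p g {zero}  f = refl
  fromℕ-sumOfSquares p g {suc n} f with p (f zero)
  ... | false = trans (fromℕ-sumOfSquares p g (f ∘ suc)) (sym (trans (+-congʳ (zeroˡ _)) (+-identityˡ _)))
  ... | true  = begin-equality
    fromℕ (m ℕ.* (m ℕ.* 1) ℕ.+ rest)
      ≈⟨ ×-homo-+ 1# (m ℕ.* (m ℕ.* 1)) rest ⟩
    fromℕ (m ℕ.* (m ℕ.* 1)) + fromℕ rest
      ≈⟨ +-cong (reflexive (≡.cong (λ k → fromℕ (m ℕ.* k)) (ℕₚ.*-identityʳ m))) (fromℕ-sumOfSquares p g (f ∘ suc)) ⟩
    fromℕ (m ℕ.* m) + _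
      ≈⟨ +-congʳ (trans (×1-homo-* m m) (sym (*-identityˡ _))) ⟩
    1# * (fromℕ m * fromℕ m) + _  ∎
    where
    m = g (f zero)
    rest = ListAction.sum (List.map (ℕ._^ 2) (List.map g (filterᵇ p (tabulate (f ∘ suc)))))

  before : ∀ {n} → Matrix n
  before i j = ind (toℕ i ℕ.<ᵇ toℕ j)

  module _ {n} (d : Fin n → Bool) where
    D : Vector Carrier n
    D i = ind (d i)

    later : Vector Carrier n
    later = before *ᵛ D

    -- The later of two positions decides adjacency; the diagonal vanishes because `before` is
    -- strict.
    threshold : Matrix n
    threshold i j = before j i * D i + before i j * D j

    F : Carrier
    F = ∑ᵛ (λ i → ind (not (d i)) * (later i * later i))

    testVector : Carrier → Vector Carrier n
    testVector θ i = if d i then θ else later i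

  -- Counts ordered pairs of dominating positions: each of the orders i < j and j < i gives
  -- `D d ∙ later d`, and the diagonal gives the single sum.
  ∑-later : ∀ {n} (d : Fin n → Bool) → D d ∙ later d + D d ∙ later d + ∑ᵛ (D d) ≈ ∑ᵛ (D d) * ∑ᵛ (D d)
  ∑-later {zero}  d = solve 0 (con (0 , 0) :+ con (0 , 0) :+ con (0 , 0) := con (0 , 0) :* con (0 , 0)) refl
  ∑-later {suc n} d = begin-equality
    x * later d zero + D d′ ∙ (later d ∘ suc) + (x * later d zero + D d′ ∙ (later d ∘ suc)) + (x + k)
      ≈⟨ +-congʳ (+-cong step step) ⟩
    x * k + p + (x * k + p) + (x + k)
      ≈⟨ solve 3 (λ x k p → x :* k :+ p :+ (x :* k :+ p) :+ (x :+ k)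
                    := x :+ (x :* k :+ x :* k) :+ (p :+ p :+ k)) refl x k p ⟩
    x + (x * k + x * k) + (p + p + k)
      ≈⟨ +-cong (+-congʳ x≈x²) (∑-later d′) ⟩
    x * x + (x * k + x * k) + k * k
      ≈⟨ solve 2 (λ x k → x :* x :+ (x :* k :+ x :* k) :+ k :* k := (x :+ k) :* (x :+ k)) refl x k ⟩
    (x + k) * (x + k)  ∎
    where
    d′ = d ∘ suc
    x = D d zero
    k = ∑ᵛ (D d′)
    p = D d′ ∙ later d′
    step : x * later d zero + D d′ ∙ (later d ∘ suc) ≈ x * k + p
    step = +-cong
      (*-congˡ (trans (+-cong (zeroˡ x) (sum-cong-≋ (λ j → *-identityˡ (D d′ j)))) (+-identityˡ k)))
      (sum-cong-≋ (λ i → *-congˡ {D d′ i} (trans (+-congʳ (zeroˡ x)) (+-identityˡ (later d′ i)))))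
    x≈x² : x ≈ x * x
    x≈x² with d zero
    ... | true  = sym (*-identityˡ 1#)
    ... | false = sym (zeroˡ 0#)

  module _ {n} (d : Fin n → Bool) (θ : Carrier) where
    private
      w = testVector d θ
      k = ∑ᵛ (D d)
      p = D d ∙ later d

    D*testVector : ∀ i → D d i * w i ≈ θ * D d i
    D*testVector i with d i
    ... | true  = *-comm 1# θ
    ... | false = trans (zeroˡ _) (sym (zeroʳ θ))

    testVector*later : w ∙ later d ≈ F d + θ * p
    testVector*later = trans (sum-cong-≋ split) (∑-linear {n} θ _ _)
      where
      split : ∀ i → w i * later d i ≈ ind (not (d i)) * (later d i * later d i) + θ * (D d i * later d i)
      split i with d i
      ... | true  = solve 2 (λ t l → t :* l := con (0 , 0) :* (l :* l) :+ t :* (con (1 , 0) :* l)) refl θ (later d i)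
      ... | false = solve 2 (λ t l → l :* l := con (1 , 0) :* (l :* l) :+ t :* (con (0 , 0) :* l)) refl θ (later d i)

    ∥testVector∥² : ∥ w ∥² ≈ F d + θ * θ * k
    ∥testVector∥² = trans (sum-cong-≋ split) (∑-linear {n} (θ * θ) _ _)
      where
      split : ∀ i → w i * w i ≈ ind (not (d i)) * (later d i * later d i) + θ * θ * D d i
      split i with d i
      ... | true  = solve 2 (λ t l → t :* t := con (0 , 0) :* (l :* l) :+ t :* t :* con (1 , 0)) refl θ (later d i)
      ... | false = solve 2 (λ t l → l :* l := con (1 , 0) :* (l :* l) :+ t :* t :* con (0 , 0)) refl θ (later d i)

    -- The two terms of `threshold` yield the same double sum with `i` and `j` exchanged. In it the
    -- value at the dominating end of each pair is θ, and the inner sum becomes θ times `later`.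
    form-testVector : form (threshold d) w ≈ θ * (w ∙ later d) + θ * (w ∙ later d)
    form-testVector = begin-equality
      ∑ᵛ (λ i → w i * ∑ᵛ (λ j → threshold d i j * w j))
        ≈⟨ sum-cong-≋ (λ i → trans (*-distribˡ-sum {n} (w i) _) (sum-cong-≋ (expand i))) ⟩
      ∑ᵛ (λ i → ∑ᵛ (λ j → τ j i + τ i j))
        ≈⟨ sum-cong-≋ (λ i → ∑-distrib-+ {n} (λ j → τ j i) (τ i)) ⟩
      ∑ᵛ (λ i → ∑ᵛ (λ j → τ j i) + ∑ᵛ (τ i))
        ≈⟨ ∑-distrib-+ {n} (λ i → ∑ᵛ (λ j → τ j i)) (λ i → ∑ᵛ (τ i)) ⟩
      ∑ᵛ (λ i → ∑ᵛ (λ j → τ j i)) + ∑ᵛ (λ i → ∑ᵛ (τ i))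
        ≈⟨ +-congʳ (∑-comm (λ i j → τ j i)) ⟩
      ∑ᵛ (λ i → ∑ᵛ (τ i)) + ∑ᵛ (λ i → ∑ᵛ (τ i))
        ≈⟨ +-cong ∑τ ∑τ ⟩
      θ * (w ∙ later d) + θ * (w ∙ later d)  ∎
      where
      τ : Matrix n
      τ i j = w i * (before i j * (D d j * w j))
      expand : ∀ i j → w i * (threshold d i j * w j) ≈ τ j i + τ i j
      expand i j = solve 6 (λ w w′ l l′ d d′ →
        w :* ((l′ :* d :+ l :* d′) :* w′) := w′ :* (l′ :* (d :* w)) :+ w :* (l :* (d′ :* w′)))
        refl (w i) (w j) (before i j) (before j i) (D d i) (D d j)
      ∑τ : ∑ᵛ (λ i → ∑ᵛ (τ i)) ≈ θ * (w ∙ later d)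
      ∑τ = begin-equality
        ∑ᵛ (λ i → ∑ᵛ (τ i))
          ≈⟨ sum-cong-≋ (λ i → sum-cong-≋ (λ j → trans (*-congˡ (*-congˡ (D*testVector j)))
               (solve 4 (λ w l t d → w :* (l :* (t :* d)) := t :* w :* (l :* d)) refl (w i) (before i j) θ (D d j)))) ⟩
        ∑ᵛ (λ i → ∑ᵛ (λ j → θ * w i * (before i j * D d j)))
          ≈⟨ sum-cong-≋ (λ i → trans (sym (*-distribˡ-sum {n} (θ * w i) _)) (*-assoc θ (w i) (later d i))) ⟩
        ∑ᵛ (λ i → θ * (w i * later d i))
          ≈⟨ *-distribˡ-sum {n} θ _ ⟨
        θ * (w ∙ later d)  ∎

    -- With p = `D d ∙ later d`, the form is θ (2F + 2θp), the squared norm is F + θ²k, and 2p = k²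
    -- - k. The hypothesis is the eigenvalue equation summed over the dominating positions.
    rayleigh-testVector : θ * θ * k ≈ θ * (k * k - k) + F d → form (threshold d) w ≈ θ * ∥ w ∥²
    rayleigh-testVector eq = begin-equality
      form (threshold d) w
        ≈⟨ trans form-testVector (+-cong (*-congˡ testVector*later) (*-congˡ testVector*later)) ⟩
      θ * (f + θ * p) + θ * (f + θ * p)
        ≈⟨ solve 4 (λ t f p k → t :* (f :+ t :* p) :+ t :* (f :+ t :* p)
             := t :* (f :+ (t :* (p :+ p :+ k :- k) :+ f))) refl θ f p k ⟩
      θ * (f + (θ * (p + p + k - k) + f))
        ≈⟨ *-congˡ (+-congˡ (+-congʳ (*-congˡ (+-congʳ (∑-later d))))) ⟩
      θ * (f + (θ * (k * k - k) + f))
        ≈⟨ *-congˡ (+-congˡ eq) ⟨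
      θ * (f + θ * θ * k)
        ≈⟨ *-congˡ ∥testVector∥² ⟨
      θ * ∥ w ∥²  ∎
      where
      f = F d

-- Transfer to threshold graphs.

module ThresholdGraphs {a ℓ₁ ℓ₂ : Level} (ℝ : CompleteOrderedField a ℓ₁ ℓ₂) where
  open CompleteOrderedField ℝ hiding (zero)
  open OrderedFieldProperties ℝ
  open QuadraticForms ℝ
  open RayleighPrinciple ℝ
  open ThresholdForms ℝ
  open Spectrum ℝ
  open SemiringSum semiring renaming (sum to ∑ᵛ)
  open PosetReasoning poset
  open IntegerCoefficients commutativeRing

  module _ {n} {G : SimpleGraph (suc n)} (T : ThresholdOrder G) where
    open SimpleGraph G
    open ThresholdOrder T

    -- The first vertex, of type 1 only by convention, is counted with the type 0 vertices.
    dominating : Fin (suc n) → Bool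
    dominating zero    = false
    dominating (suc i) = type (suc i)

    dominatingCount : Carrier
    dominatingCount = ∑ᵛ (D dominating)

    private
      k = dominatingCount
      A = adjacencyMatrix ℝ
      type-zero : type zero ≡ true
      type-zero = type-first zero ≡.refl

    fromℕ-numType1 : fromℕ numType1 ≈ 1# + k
    fromℕ-numType1 = begin-equality
      fromℕ numType1                               ≈⟨ fromℕ-count type (λ i → i) ⟩
      ind (type zero) + ∑ᵛ (ind ∘ type ∘ suc)      ≈⟨ +-cong (reflexive (≡.cong ind type-zero)) (sym (+-identityˡ _)) ⟩
      1# + k                                       ∎

    -- `type` and `dominating` differ only at position zero, which comes after no position.
    fromℕ-backwardsPosition : ∀ i →
      fromℕ (length (filterᵇ (λ j → (toℕ i ℕ.<ᵇ toℕ j) ∧ type j) (allFin (suc n)))) ≈ later dominating i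
    fromℕ-backwardsPosition i = trans (fromℕ-count isLater (λ j → j)) (sum-cong-≋ pointwise)
      where
      isLater : Fin (suc n) → Bool
      isLater j = (toℕ i ℕ.<ᵇ toℕ j) ∧ type j
      pointwise : ∀ j → ind (isLater j) ≈ before i j * D dominating j
      pointwise zero    = sym (zeroˡ _)
      pointwise (suc j) = ind-∧ (toℕ i ℕ.<ᵇ toℕ (suc j)) (type (suc j))

    later-zero : later dominating zero ≈ k
    later-zero = +-cong (zeroˡ _) (sum-cong-≋ (λ j → *-identityˡ (D dominating (suc j))))

    -- The summand k² belongs to position zero, which is independent for `dominating` but not among
    -- the `type0Positions`.
    F-dominating : F dominating ≈ k * k + fromℕ F₁
    F-dominating = begin-equality
      1# * (later dominating zero * later dominating zero) + F′
        ≈⟨ +-congʳ (trans (*-identityˡ _) (*-cong later-zero later-zero)) ⟩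
      k * k + F′
        ≈⟨ +-congˡ (+-identityˡ F′) ⟨
      k * k + (0# + F′)
        ≈⟨ +-congˡ (+-cong (zeroˡ _) (sum-cong-≋ (λ i → *-congˡ {ind (not (type (suc i)))} (*-cong (b≈ (suc i)) (b≈ (suc i)))))) ⟨
      k * k + (0# * _ + ∑ᵛ (λ i → ind (not (type (suc i))) * (b (suc i) * b (suc i))))
        ≈⟨ +-congˡ (+-congʳ (*-congʳ (reflexive (≡.cong (ind ∘ not) type-zero)))) ⟨
      k * k + ∑ᵛ (λ i → ind (not (type i)) * (b i * b i))
        ≈⟨ +-congˡ (fromℕ-sumOfSquares (not ∘ type) _ (λ i → i)) ⟨
      k * k + fromℕ F₁  ∎
      where
      F′ = ∑ᵛ (λ i → ind (not (type (suc i))) * (later dominating (suc i) * later dominating (suc i)))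
      b : Vector Carrier (suc n)
      b i = fromℕ (length (filterᵇ (λ j → (toℕ i ℕ.<ᵇ toℕ j) ∧ type j) (allFin (suc n))))
      b≈ = fromℕ-backwardsPosition

    type-dominating : ∀ {i j : Fin (suc n)} → toℕ j ℕ.< toℕ i → type i ≡ dominating i
    type-dominating {suc i} _ = ≡.refl

    adj-position : ∀ i j → A (vertexAt ⟨$⟩ʳ i) (vertexAt ⟨$⟩ʳ j) ≈ threshold dominating i j
    adj-position i j with Finₚ.<-cmp i j
    ... | tri< i<j _ j≮i = begin-equality
      A (vertexAt ⟨$⟩ʳ i) (vertexAt ⟨$⟩ʳ j)
        ≡⟨ ≡.cong ind (≡.trans (adj-sym _ _) (≡.trans (adj-type j i i<j) (type-dominating i<j))) ⟩
      D dominating j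
        ≈⟨ solve 2 (λ x y → y := con (0 , 0) :* x :+ con (1 , 0) :* y) refl (D dominating i) (D dominating j) ⟩
      0# * D dominating i + 1# * D dominating j
        ≡⟨ ≡.cong₂ (λ b c → ind b * D dominating i + ind c * D dominating j)
             (dec-false (toℕ j ℕ.<? toℕ i) j≮i) (dec-true (toℕ i ℕ.<? toℕ j) i<j) ⟨
      threshold dominating i j  ∎
    ... | tri> i≮j _ j<i = begin-equality
      A (vertexAt ⟨$⟩ʳ i) (vertexAt ⟨$⟩ʳ j)
        ≡⟨ ≡.cong ind (≡.trans (adj-type i j j<i) (type-dominating j<i)) ⟩
      D dominating i
        ≈⟨ solve 2 (λ x y → x := con (1 , 0) :* x :+ con (0 , 0) :* y) refl (D dominating i) (D dominating j) ⟩
      1# * D dominating i + 0# * D dominating j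
        ≡⟨ ≡.cong₂ (λ b c → ind b * D dominating i + ind c * D dominating j)
             (dec-true (toℕ j ℕ.<? toℕ i) j<i) (dec-false (toℕ i ℕ.<? toℕ j) i≮j) ⟨
      threshold dominating i j  ∎
    ... | tri≈ i≮j ≡.refl j≮i = begin-equality
      A (vertexAt ⟨$⟩ʳ i) (vertexAt ⟨$⟩ʳ j)
        ≡⟨ ≡.cong ind (adj-irrefl _) ⟩
      0#
        ≈⟨ solve 2 (λ x y → con (0 , 0) := con (0 , 0) :* x :+ con (0 , 0) :* y) refl (D dominating i) (D dominating j) ⟩
      0# * D dominating i + 0# * D dominating j
        ≡⟨ ≡.cong₂ (λ b c → ind b * D dominating i + ind c * D dominating j)
             (dec-false (toℕ j ℕ.<? toℕ i) j≮i) (dec-false (toℕ i ℕ.<? toℕ j) i≮j) ⟨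
      threshold dominating i j  ∎

    0≤dominatingCount : 0# ≤ k
    0≤dominatingCount = 0≤f⇒0≤∑f (λ i → 0≤ind (dominating i))

    -- The later endpoint of an edge has type 1 and cannot be the first vertex.
    edge⇒dominating : ∀ u v → adj u v ≡ true → ∃ λ i → dominating i ≡ true
    edge⇒dominating u v uv = larger (vertexAt ⟨$⟩ˡ u) (vertexAt ⟨$⟩ˡ v)
      (≡.trans (≡.cong₂ adj (inverseʳ vertexAt) (inverseʳ vertexAt)) uv)
      where
      larger : ∀ i j → adj (vertexAt ⟨$⟩ʳ i) (vertexAt ⟨$⟩ʳ j) ≡ true → ∃ λ i → dominating i ≡ true
      larger i j ij with Finₚ.<-cmp i j
      ... | tri< i<j _ _ = j , ≡.trans (≡.sym (≡.trans (≡.trans (adj-sym _ _) (adj-type j i i<j)) (type-dominating i<j))) ij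
      ... | tri> _ _ j<i = i , ≡.trans (≡.sym (≡.trans (adj-type i j j<i) (type-dominating j<i))) ij
      ... | tri≈ _ ≡.refl _ = contradiction (≡.trans (≡.sym ij) (adj-irrefl _)) λ ()

    dominatingCount≉0 : (∃ λ i → dominating i ≡ true) → ¬ k ≈ 0#
    dominatingCount≉0 (i , di) k≈0 = 1≰0 (begin
      1#              ≡⟨ ≡.cong ind di ⟨
      D dominating i  ≤⟨ f≤∑f (λ j → 0≤ind (dominating j)) i ⟩
      k               ≈⟨ k≈0 ⟩
      0#              ∎)

    adjacency-sym : Symmetric A
    adjacency-sym u v = reflexive (≡.cong ind (adj-sym u v))

    -- The test vector is carried from positions to vertices along `vertexAt`. At the first vertex
    -- its value is k whatever θ is, so it is non-zero.
    rayleighBound : ¬ k ≈ 0# → ∀ {θ} → θ * θ * k ≈ θ * (k * k - k) + (k * k + fromℕ F₁) → RayleighBound A θ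
    rayleighBound k≉0 {θ} eq = x , (λ N≈0 → k≉0 (begin-equality
        k                         ≈⟨ later-zero ⟨
        later dominating zero     ≈⟨ ∥x∥²≈0⇒x≈0 w (trans (sym ∥x∥²≈∥w∥²) N≈0) zero ⟩
        0#                        ∎)) , (begin
        θ * ∥ x ∥²                 ≈⟨ *-congˡ ∥x∥²≈∥w∥² ⟩
        θ * ∥ w ∥²                 ≈⟨ rayleigh-testVector dominating θ (trans eq (+-congˡ (sym F-dominating))) ⟨
        form (threshold dominating) w ≈⟨ form≈ ⟨
        form A x                  ∎)
      where
      w = testVector dominating θ
      x : Vector Carrier (suc n)
      x v = w (vertexAt ⟨$⟩ˡ v)
      x≈w : ∀ i → x (vertexAt ⟨$⟩ʳ i) ≈ w i
      x≈w i = reflexive (≡.cong w (inverseˡ vertexAt))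
      ∥x∥²≈∥w∥² : ∥ x ∥² ≈ ∥ w ∥²
      ∥x∥²≈∥w∥² = trans (sum-permute (λ v → x v * x v) vertexAt) (sum-cong-≋ (λ i → *-cong (x≈w i) (x≈w i)))
      form≈ : form A x ≈ form (threshold dominating) w
      form≈ = trans (sum-permute (λ v → x v * (A *ᵛ x) v) vertexAt) (sum-cong-≋ (λ i → *-cong (x≈w i)
        (trans (sum-permute (λ v → A (vertexAt ⟨$⟩ʳ i) v * x v) vertexAt)
               (sum-cong-≋ (λ j → *-cong (adj-position i j) (x≈w j))))))

  -- The quadratic equation for θ and the final bound.

  connected⇒edge : ∀ {n} {G : SimpleGraph (suc (suc n))} → let open SimpleGraph G in
                   Connected → ∃₂ λ u v → adj u v ≡ true
  connected⇒edge connected with connected zero (suc zero)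
  ... | uv ◅ _ = _ , _ , uv

  -- The quadratic formula. After division by k the discriminant is (k - 1)² + 4k + 4f/k = (k + 1)²
  -- + 4f/k, which explains the c² in the bound. The inverses `h` of 2 and `j` of k enter only
  -- through their defining equations, so that the solver can treat them as variables.
  quadraticRoot : ∀ k f {h j r} → (1# + 1#) * h ≈ 1# → k * j ≈ 1# →
    r * r ≈ (1# + k) * (1# + k) + (1# + 1#) * (1# + 1#) * j * f →
    let θ = (k - 1# + r) * h in θ * θ * k ≈ θ * (k * k - k) + (k * k + f)
  quadraticRoot k f {h} {j} {r} 2h≈1 kj≈1 r²≈ = begin-equality
    θ * θ * k
      -- With θ = (k - 1 + r) h one has θ - (k - 1) = h (r - (k - 1)) + (2h - 1)(k - 1). The last
      -- summand vanishes once 2h = 1 is used.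
      ≈⟨ solve 3 (λ k h r →
           let θ = (k :- one :+ r) :* h in
           θ :* θ :* k := θ :* (k :* k :- k) :+
             (k :* h :* h :* (r :* r :- (k :- one) :* (k :- one)) :+ k :* θ :* (k :- one) :* ((one :+ one) :* h :- one)))
           refl k h r ⟩
    θ * (k * k - k) + (k * h * h * (r * r - (k - 1#) * (k - 1#)) + k * θ * (k - 1#) * ((1# + 1#) * h - 1#))
      ≈⟨ +-congˡ (+-cong (*-congˡ (+-congʳ r²≈)) (*-congˡ (+-congʳ 2h≈1))) ⟩
    θ * (k * k - k) + (k * h * h * ((1# + k) * (1# + k) + (1# + 1#) * (1# + 1#) * j * f - (k - 1#) * (k - 1#))
                       + k * θ * (k - 1#) * (1# - 1#))
      ≈⟨ +-congˡ (solve 5 (λ k f h j t →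
           k :* h :* h :* ((one :+ k) :* (one :+ k) :+ (one :+ one) :* (one :+ one) :* j :* f :- (k :- one) :* (k :- one))
             :+ k :* t :* (k :- one) :* (one :- one) :=
           (one :+ one) :* h :* ((one :+ one) :* h) :* (k :* k :+ k :* j :* f)) refl k f h j θ) ⟩
    θ * (k * k - k) + (1# + 1#) * h * ((1# + 1#) * h) * (k * k + k * j * f)
      ≈⟨ +-congˡ (*-cong (*-cong 2h≈1 2h≈1) (+-congˡ (*-congʳ kj≈1))) ⟩
    θ * (k * k - k) + 1# * 1# * (k * k + 1# * f)
      ≈⟨ +-congˡ (solve 2 (λ k f → one :* one :* (k :* k :+ one :* f) := k :* k :+ f) refl k f) ⟩
    θ * (k * k - k) + (k * k + f)  ∎
    where
    θ = (k - 1# + r) * h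
    one : ∀ {m} → Polynomial m
    one = con (1 , 0)

  spectralRadius-bound : ∀ {n} {G : SimpleGraph (suc (suc n))} (T : ThresholdOrder G) →
    let open SimpleGraph G
        open ThresholdOrder T renaming (numType1 to c)
    in
    Connected → ∀ {ρ} → IsSpectralRadius (adjacencyMatrix ℝ) ρ →
    (fromℕ c - fromℕ 2
       + √ (fromℕ c * fromℕ c + fromℕ 4 / (fromℕ c - fromℕ 1) * fromℕ F₁))
      / fromℕ 2
    ≤ ρ
  spectralRadius-bound {G = G} T connected {ρ} isRadius = begin
    (fromℕ c - fromℕ 2 + r) * h  ≈⟨ *-congʳ (+-congʳ c-2≈k-1) ⟩
    (k - 1# + r) * h             ≤⟨ rayleigh≤spectralRadius (adjacency-sym T) isRadius
                                      (rayleighBound T k≉0 (quadraticRoot k (fromℕ F₁) 2h≈1 kj≈1 r²≈)) ⟩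
    ρ                            ∎
    where
    open ThresholdOrder T renaming (numType1 to c)
    k = dominatingCount T
    X = fromℕ c * fromℕ c + fromℕ 4 / (fromℕ c - fromℕ 1) * fromℕ F₁
    h = fromℕ 2 ⁻¹
    j = (fromℕ c - fromℕ 1) ⁻¹
    r = √ X
    one nil : ∀ {m} → Polynomial m
    one = con (1 , 0)
    nil = con (0 , 0)

    k≉0 : ¬ k ≈ 0#
    k≉0 with connected⇒edge {G = G} connected
    ... | u , v , uv = dominatingCount≉0 T (edge⇒dominating T u v uv)

    0≤fromℕ : ∀ m → 0# ≤ fromℕ m
    0≤fromℕ zero    = ≤-refl
    0≤fromℕ (suc m) = +-nonNeg 0≤1 (0≤fromℕ m)

    c-2≈k-1 : fromℕ c - fromℕ 2 ≈ k - 1#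
    c-2≈k-1 = trans (+-congʳ (fromℕ-numType1 T))
      (solve 1 (λ k → one :+ k :- (one :+ (one :+ nil)) := k :- one) refl k)

    c-1≈k : fromℕ c - fromℕ 1 ≈ k
    c-1≈k = trans (+-congʳ (fromℕ-numType1 T))
      (solve 1 (λ k → one :+ k :- (one :+ nil) := k) refl k)

    c-1≉0 : ¬ fromℕ c - fromℕ 1 ≈ 0#
    c-1≉0 eq = k≉0 (trans (sym c-1≈k) eq)

    2h≈1 : (1# + 1#) * h ≈ 1#
    2h≈1 = trans (*-congʳ (+-congˡ (sym (+-identityʳ 1#))))
      (⁻¹-inverseʳ (fromℕ 2) (λ 2≈0 → 1≰0 (≤-trans (x≤x+y 1# (0≤fromℕ 1)) (≤-reflexive 2≈0))))

    kj≈1 : k * j ≈ 1#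
    kj≈1 = trans (*-congʳ (sym c-1≈k)) (⁻¹-inverseʳ _ c-1≉0)

    -- `√` is extended by zero to negative arguments, so `r * r ≈ X` depends on this.
    0≤X : 0# ≤ X
    0≤X = +-nonNeg (0≤x² (fromℕ c)) (*-nonNeg (*-nonNeg (0≤fromℕ 4)
      (⁻¹-nonNeg (≤-trans (0≤dominatingCount T) (≤-reflexive (sym c-1≈k))) c-1≉0)) (0≤fromℕ F₁))

    r²≈ : r * r ≈ (1# + k) * (1# + k) + (1# + 1#) * (1# + 1#) * j * fromℕ F₁
    r²≈ = trans (proj₂ (√-spec 0≤X)) (+-cong (*-cong (fromℕ-numType1 T) (fromℕ-numType1 T))
      (*-congʳ (*-congʳ (solve 0 (one :+ (one :+ (one :+ (one :+ nil))) := (one :+ one) :* (one :+ one)) refl))))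

theorem6p1 :
  ∀ {a ℓ₁ ℓ₂} (ℝ : CompleteOrderedField a ℓ₁ ℓ₂) →
  let open CompleteOrderedField ℝ
      open Spectrum ℝ
  in
  ∀ (n : ℕ) (G : SimpleGraph n) (T : ThresholdOrder G) →
  let open SimpleGraph G
      open ThresholdOrder T renaming (numType1 to c)
  in
  Connected →
  n ≥ 4 →
  n ∸ 1 < size →
  size < n C 2 →
  ∀ (ρ : Carrier) → IsSpectralRadius (adjacencyMatrix ℝ) ρ →
  (fromℕ c - fromℕ 2
     + √ (fromℕ c * fromℕ c + fromℕ 4 / (fromℕ c - fromℕ 1) * fromℕ F₁))
    / fromℕ 2
  ≤ ρ
theorem6p1 ℝ (suc zero)    G T _         (s≤s ()) _ _ ρ _
theorem6p1 ℝ (suc (suc _)) G T connected _        _ _ ρ isRadius =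
  ThresholdGraphs.spectralRadius-bound ℝ T connected isRadius
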